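{- Let $y=y(N)\ge 2$ be a real-valued function of the integer $N\ge 2$ satisfying $y(N)=o(\log N)$ as $N\to\infty$. Then, as $N\to\infty$, uniformly for integers $k\geq 1$, $$M_k(N,y)\sim \Psi(N^k,y);$$ that is, $\sup_{k\ge 1}\left|\frac{M_k(N,y(N))}{\Psi(N^k,y(N))}-1\right|\to 0$ as $N\to\infty$.
   Context: $P^{+}(n)$ denotes the largest prime factor of the positive integer $n$, with $P^{+}(1):=1$. Write $[N]:=\{1,\ldots,N\}$. For integers $N\ge 2$, $k\geq 1$ and real $y$, $$M_k(N,y):=\#\{x_1\cdots x_k : x_i\in[N],\ P^{+}(x_i)\leq y\text{ for all } i\}$$ is the number of distinct products of $k$ $y$-smooth integers from $[N]$. Also $\Psi(x,y):=\#\{n\leq x : P^{+}(n)\leq y\}$, where $n$ ranges over positive integers. -}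

module Defs where

open import Data.Integer as ℤ using (+_; +[1+_]; -[1+_])
import Data.Integer.Properties as ℤ
open import Data.List using (List; length)
open import Data.List.Extrema.Nat using (max)
open import Data.List.Membership.Propositional using (_∈_)
open import Data.List.Relation.Unary.Unique.Propositional using (Unique)
open import Data.Nat as ℕ using (ℕ; zero; suc; _∸_)
open import Data.Nat.Primality.Factorisation using (factors; factorise)
import Data.Nat.Properties as ℕ
import Data.Integer.Tactic.RingSolver as ℤ-Ring
import Data.Nat.Tactic.RingSolver as ℕ-Ring
open import Data.Product using (Σ; ∃-syntax; _×_; _,_)
open import Data.Rational
open import Data.Rational.Properties
open import Data.Rational.Solver using (module +-*-Solver)
import Data.Rational.Unnormalised as ℚᵘ
import Data.Rational.Unnormalised.Properties as ℚᵘ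
open import Data.Sum using (_⊎_; inj₁; inj₂)
open import Data.Vec using (Vec; foldr′)
open import Data.Vec.Relation.Unary.All using (All)
open import Function using (_∘_; _⇔_)
open import Relation.Binary.PropositionalEquality
  using (_≡_; refl; sym; trans; cong; cong₂; subst; subst₂)
open import Relation.Nullary using (¬_; yes; no)

-- The real numbers: two-sided Dedekind cuts in ℚ.

record ℝ : Set₁ where
  field
    L U         : ℚ → Set
    L-inhabited : ∃[ q ] L q
    U-inhabited : ∃[ q ] U q
    L-closed    : ∀ {q r} → q < r → L r → L q
    U-closed    : ∀ {q r} → q < r → U q → U r
    L-open      : ∀ {q} → L q → ∃[ r ] (q < r × L r)
    U-open      : ∀ {r} → U r → ∃[ q ] (q < r × U q)
    disjoint    : ∀ {q} → L q → ¬ U q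
    located     : ∀ {q r} → q < r → L q ⊎ U r

infix 4 _≤ᴿ_

_≤ᴿ_ : ℝ → ℝ → Set
x ≤ᴿ y = ∀ {q} → ℝ.L x q → ℝ.L y q

p-1<p : ∀ p → p - 1ℚ < p
p-1<p p = subst (p - 1ℚ <_) (+-identityʳ p) (+-monoʳ-< p (negative⁻¹ (- 1ℚ)))

p<p+1 : ∀ p → p < p + 1ℚ
p<p+1 p = subst (_< p + 1ℚ) (+-identityʳ p) (+-monoʳ-< p (positive⁻¹ 1ℚ))

fromℚ : ℚ → ℝ
fromℚ p = record
  { L           = _< p
  ; U           = p <_
  ; L-inhabited = p - 1ℚ , p-1<p p
  ; U-inhabited = p + 1ℚ , p<p+1 p
  ; L-closed    = <-trans
  ; U-closed    = λ q<r p<q → <-trans p<q q<r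
  ; L-open      = <-dense
  ; U-open      = λ p<r → let (m , p<m , m<r) = <-dense p<r in m , m<r , p<m
  ; disjoint    = <-asym
  ; located     = located
  }
  where
  located : ∀ {q r} → q < r → q < p ⊎ p < r
  located {q} q<r with q <? p
  ... | yes q<p = inj₁ q<p
  ... | no  q≮p = inj₂ (≤-<-trans (≮⇒≥ q≮p) q<r)

fromℕℚ : ℕ → ℚ
fromℕℚ n = + n / 1

fromℕ : ℕ → ℝ
fromℕ n = fromℚ (fromℕℚ n)

infixl 7 _·_

_·_ : (ε : ℚ) .{{_ : Positive ε}} → ℝ → ℝ
ε · x = record
  { L           = L ∘ _/ε
  ; U           = U ∘ _/ε
  ; L-inhabited = let (q , l) = L-inhabited in q * ε , subst L (sym (*ε/ε q)) l
  ; U-inhabited = let (q , u) = U-inhabited in q * ε , subst U (sym (*ε/ε q)) u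
  ; L-closed    = L-closed ∘ /ε-mono
  ; U-closed    = U-closed ∘ /ε-mono
  ; L-open      = λ {q} l → let (r , q/ε<r , l′) = L-open l in
      r * ε
      , subst (_< r * ε) (/ε*ε q) (*-monoˡ-<-pos ε q/ε<r)
      , subst L (sym (*ε/ε r)) l′
  ; U-open      = λ {r} u → let (q , q<r/ε , u′) = U-open u in
      q * ε
      , subst (q * ε <_) (/ε*ε r) (*-monoˡ-<-pos ε q<r/ε)
      , subst U (sym (*ε/ε q)) u′
  ; disjoint    = disjoint
  ; located     = located ∘ /ε-mono
  }
  where
  open ℝ x
  instance
    ε≢0 : NonZero ε
    ε≢0 = pos⇒nonZero ε
    1/ε>0 : Positive (1/ ε)
    1/ε>0 = 1/pos⇒pos ε
  _/ε : ℚ → ℚ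
  q /ε = q ÷ ε
  /ε-mono : ∀ {q r} → q < r → q /ε < r /ε
  /ε-mono = *-monoˡ-<-pos (1/ ε)
  *ε/ε : ∀ q → (q * ε) /ε ≡ q
  *ε/ε q = trans (*-assoc q ε (1/ ε))
                 (trans (cong (q *_) (*-inverseʳ ε)) (*-identityʳ q))
  /ε*ε : ∀ q → (q /ε) * ε ≡ q
  /ε*ε q = trans (*-assoc q (1/ ε) ε)
                 (trans (cong (q *_) (*-inverseˡ ε)) (*-identityʳ q))

-- The natural logarithm of N ≥ 1, as the integral of 1/t over [1, N]: for
-- n ≥ 1, cut [1, N] into n(N-1) pieces of length 1/n; the lower and upper
-- Riemann sums of 1/t are then Σ 1/(n+1+i) and Σ 1/(n+i) over i < n(N-1).

recip : ℕ → ℚ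
recip i = + 1 / suc i

-- harmonic a l  =  Σ_{i<l} 1/(a+1+i)
harmonic : ℕ → ℕ → ℚ
harmonic a zero    = 0ℚ
harmonic a (suc l) = harmonic a l + recip (a ℕ.+ l)

-- The argument n stands for a mesh of 1/(n+1).
lowerSum upperSum : ℕ → ℕ → ℚ
lowerSum N n = harmonic (suc n) (suc n ℕ.* (N ∸ 1))
upperSum N n = harmonic n       (suc n ℕ.* (N ∸ 1))

toℚᵘ-/ : ∀ i d → toℚᵘ (i / suc d) ℚᵘ.≃ ℚᵘ.mkℚᵘ i d
toℚᵘ-/ i d = toℚᵘ-fromℚᵘ (ℚᵘ.mkℚᵘ i d)

recip-pos : ∀ i → 0ℚ < recip i
recip-pos i = positive⁻¹ (recip i) {{normalize-pos 1 (suc i)}}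

recip-anti : ∀ i j → i ℕ.≤ j → recip j ≤ recip i
recip-anti i j i≤j = toℚᵘ-cancel-≤
  (ℚᵘ.≤-respʳ-≃ (ℚᵘ.≃-sym (toℚᵘ-/ (+ 1) i))
  (ℚᵘ.≤-respˡ-≃ (ℚᵘ.≃-sym (toℚᵘ-/ (+ 1) j))
  (ℚᵘ.*≤* (ℤ.*-monoˡ-≤-nonNeg (+ 1) (ℤ.+≤+ (ℕ.s≤s i≤j))))))

fromℕℚ-suc : ∀ n → fromℕℚ (suc n) ≡ fromℕℚ n + 1ℚ
fromℕℚ-suc n = toℚᵘ-injective
  (ℚᵘ.≃-trans (toℚᵘ-/ (+ suc n) 0)
  (ℚᵘ.≃-trans (ℚᵘ.*≡* (eq (+ n)))
  (ℚᵘ.≃-sym (ℚᵘ.≃-trans (toℚᵘ-homo-+ (fromℕℚ n) 1ℚ)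
                        (ℚᵘ.+-congˡ ℚᵘ.1ℚᵘ (toℚᵘ-/ (+ n) 0))))))
  where
  eq : ∀ i → (+ 1 ℤ.+ i) ℤ.* + 1 ≡ (i ℤ.* + 1 ℤ.+ + 1 ℤ.* + 1) ℤ.* + 1
  eq = ℤ-Ring.solve-∀

fromℕℚ*recip : ∀ m i → fromℕℚ (suc m) * recip (i ℕ.+ m ℕ.* suc i) ≡ recip i
fromℕℚ*recip m i = toℚᵘ-injective
  (ℚᵘ.≃-trans (toℚᵘ-homo-* (fromℕℚ (suc m)) (recip c))
  (ℚᵘ.≃-trans (ℚᵘ.*-cong (toℚᵘ-/ (+ suc m) 0) (toℚᵘ-/ (+ 1) c))
  (ℚᵘ.≃-trans (ℚᵘ.*≡* (cong +_ (eq m i)))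
              (ℚᵘ.≃-sym (toℚᵘ-/ (+ 1) i)))))
  where
  c = i ℕ.+ m ℕ.* suc i
  eq : ∀ m i → suc m ℕ.* 1 ℕ.* suc i ≡ 1 ℕ.* (1 ℕ.* suc (i ℕ.+ m ℕ.* suc i))
  eq = ℕ-Ring.solve-∀

harmonic-++ : ∀ a l l′ → harmonic a (l ℕ.+ l′) ≡ harmonic a l + harmonic (a ℕ.+ l) l′
harmonic-++ a l zero
  rewrite ℕ.+-identityʳ l = sym (+-identityʳ (harmonic a l))
harmonic-++ a l (suc l′)
  rewrite ℕ.+-suc l l′ | harmonic-++ a l l′ | ℕ.+-assoc a l l′
  = +-assoc (harmonic a l) _ _

fromℕℚ-suc-* : ∀ l x → fromℕℚ (suc l) * x ≡ fromℕℚ l * x + x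
fromℕℚ-suc-* l x =
  trans (cong (_* x) (fromℕℚ-suc l))
  (trans (*-distribʳ-+ x (fromℕℚ l) 1ℚ)
         (cong (_+_ (fromℕℚ l * x)) (*-identityˡ x)))

harmonic-≥ : ∀ a l c → a ℕ.+ l ℕ.≤ suc c → fromℕℚ l * recip c ≤ harmonic a l
harmonic-≥ a zero    c h = ≤-reflexive (*-zeroˡ (recip c))
harmonic-≥ a (suc l) c h =
  subst (_≤ harmonic a (suc l)) (sym (fromℕℚ-suc-* l (recip c)))
    (+-mono-≤ (harmonic-≥ a l c (ℕ.m≤n⇒m≤1+n a+l≤c)) (recip-anti (a ℕ.+ l) c a+l≤c))
  where
  a+l≤c : a ℕ.+ l ℕ.≤ c
  a+l≤c = ℕ.s≤s⁻¹ (subst (ℕ._≤ suc c) (ℕ.+-suc a l) h)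

harmonic-≤ : ∀ a l → harmonic a l ≤ fromℕℚ l * recip a
harmonic-≤ a zero    = ≤-reflexive (sym (*-zeroˡ (recip a)))
harmonic-≤ a (suc l) =
  subst (harmonic a (suc l) ≤_) (sym (fromℕℚ-suc-* l (recip a)))
    (+-mono-≤ (harmonic-≤ a l) (recip-anti a (a ℕ.+ l) (ℕ.m≤m+n a l)))

harmonic-anti : ∀ a l → harmonic (suc a) l ≤ harmonic a l
harmonic-anti a zero    = ≤-refl
harmonic-anti a (suc l) = +-mono-≤ (harmonic-anti a l) (recip-anti (a ℕ.+ l) (suc a ℕ.+ l) (ℕ.n≤1+n (a ℕ.+ l)))

block-suc : ∀ m l → suc m ℕ.* suc l ≡ suc m ℕ.* l ℕ.+ suc m
block-suc = ℕ-Ring.solve-∀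

block-start : ∀ m a l → a ℕ.+ m ℕ.* suc a ℕ.+ suc m ℕ.* l
                      ≡ (a ℕ.+ l) ℕ.+ m ℕ.* suc (a ℕ.+ l)
block-start = ℕ-Ring.solve-∀

-- Refining the mesh by a factor m+1.
refine-lower : ∀ m a l →
  harmonic a l ≤ harmonic (suc m ℕ.* a) (suc m ℕ.* l)
refine-lower m a zero rewrite ℕ.*-zeroʳ m = ≤-refl
refine-lower m a (suc l) = begin
  harmonic a l + recip (a ℕ.+ l)               ≤⟨ +-mono-≤ (refine-lower m a l) block ⟩
  harmonic A L + harmonic (A ℕ.+ L) (suc m)    ≡⟨ harmonic-++ A L (suc m) ⟨
  harmonic A (L ℕ.+ suc m)                     ≡⟨ cong (harmonic A) (block-suc m l) ⟨
  harmonic A (suc m ℕ.* suc l)                 ∎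
  where
  open ≤-Reasoning
  A = suc m ℕ.* a
  L = suc m ℕ.* l
  block-end : ∀ m a l → suc m ℕ.* a ℕ.+ suc m ℕ.* l ℕ.+ suc m
                ≡ suc ((a ℕ.+ l) ℕ.+ m ℕ.* suc (a ℕ.+ l))
  block-end = ℕ-Ring.solve-∀
  block : recip (a ℕ.+ l) ≤ harmonic (A ℕ.+ L) (suc m)
  block = subst (_≤ harmonic (A ℕ.+ L) (suc m)) (fromℕℚ*recip m (a ℕ.+ l))
    (harmonic-≥ (A ℕ.+ L) (suc m) ((a ℕ.+ l) ℕ.+ m ℕ.* suc (a ℕ.+ l))
      (ℕ.≤-reflexive (block-end m a l)))

refine-upper : ∀ m a l →
  harmonic (a ℕ.+ m ℕ.* suc a) (suc m ℕ.* l) ≤ harmonic a l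
refine-upper m a zero rewrite ℕ.*-zeroʳ m = ≤-refl
refine-upper m a (suc l) = begin
  harmonic A (suc m ℕ.* suc l)                 ≡⟨ cong (harmonic A) (block-suc m l) ⟩
  harmonic A (L ℕ.+ suc m)                     ≡⟨ harmonic-++ A L (suc m) ⟩
  harmonic A L + harmonic (A ℕ.+ L) (suc m)    ≤⟨ +-mono-≤ (refine-upper m a l) block ⟩
  harmonic a l + recip (a ℕ.+ l)               ∎
  where
  open ≤-Reasoning
  A = a ℕ.+ m ℕ.* suc a
  L = suc m ℕ.* l
  block : harmonic (A ℕ.+ L) (suc m) ≤ recip (a ℕ.+ l)
  block = subst₂ _≤_ (cong (λ b → harmonic b (suc m)) (sym (block-start m a l)))
    (fromℕℚ*recip m (a ℕ.+ l)) (harmonic-≤ ((a ℕ.+ l) ℕ.+ m ℕ.* suc (a ℕ.+ l)) (suc m))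

harmonic-telescope : ∀ a l →
  harmonic a l + recip (a ℕ.+ l) ≡ harmonic (suc a) l + recip a
harmonic-telescope a zero    = cong (λ i → 0ℚ + recip i) (ℕ.+-identityʳ a)
harmonic-telescope a (suc l) =
  trans (cong₂ (λ h i → h + recip i) (harmonic-telescope a l) (ℕ.+-suc a l))
        (swap (harmonic (suc a) l) (recip a) (recip (suc (a ℕ.+ l))))
  where
  open +-*-Solver
  swap : ∀ h x y → (h + x) + y ≡ (h + y) + x
  swap = solve 3 (λ h x y → (h :+ x) :+ y := (h :+ y) :+ x) refl

lowerSum≤upperSum : ∀ N m n → lowerSum N m ≤ upperSum N n
lowerSum≤upperSum N m n = begin
  harmonic (suc m) (suc m ℕ.* D)                             ≤⟨ refine-lower n (suc m) (suc m ℕ.* D) ⟩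
  harmonic (suc n ℕ.* suc m) (suc n ℕ.* (suc m ℕ.* D))       ≡⟨ cong₂ harmonic (eq₁ m n) (eq₂ m n D) ⟩
  harmonic (suc (n ℕ.+ m ℕ.* suc n)) (suc m ℕ.* (suc n ℕ.* D)) ≤⟨ harmonic-anti (n ℕ.+ m ℕ.* suc n) (suc m ℕ.* (suc n ℕ.* D)) ⟩
  harmonic (n ℕ.+ m ℕ.* suc n) (suc m ℕ.* (suc n ℕ.* D))     ≤⟨ refine-upper m n (suc n ℕ.* D) ⟩
  harmonic n (suc n ℕ.* D)                                   ∎
  where
  open ≤-Reasoning
  D = N ∸ 1
  eq₁ : ∀ m n → suc n ℕ.* suc m ≡ suc (n ℕ.+ m ℕ.* suc n)
  eq₁ = ℕ-Ring.solve-∀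
  eq₂ : ∀ m n D → suc n ℕ.* (suc m ℕ.* D) ≡ suc m ℕ.* (suc n ℕ.* D)
  eq₂ = ℕ-Ring.solve-∀

upperSum≤lowerSum+mesh : ∀ N n → upperSum N n ≤ lowerSum N n + recip n
upperSum≤lowerSum+mesh N n = begin
  upperSum N n                        ≡⟨ +-identityʳ _ ⟨
  upperSum N n + 0ℚ                   ≤⟨ +-monoʳ-≤ (upperSum N n) (<⇒≤ (recip-pos (n ℕ.+ l))) ⟩
  upperSum N n + recip (n ℕ.+ l)      ≡⟨ harmonic-telescope n l ⟩
  lowerSum N n + recip n              ∎
  where
  open ≤-Reasoning
  l = suc n ℕ.* (N ∸ 1)

archimedean : ∀ {δ} → 0ℚ < δ → ∃[ n ] recip n < δ
archimedean {mkℚ +[1+ a ] d _} _ = suc d , toℚᵘ-cancel-<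
  (ℚᵘ.<-respˡ-≃ (ℚᵘ.≃-sym (toℚᵘ-/ (+ 1) (suc d)))
    (ℚᵘ.*<* (ℤ.+<+ (ℕ.≤-trans (ℕ.≤-reflexive (cong suc (ℕ.*-identityˡ (suc d))))
                              (ℕ.m≤n*m (suc (suc d)) (suc a))))))
archimedean {mkℚ (+ 0)    _ _} (*<* (ℤ.+<+ ()))
archimedean {mkℚ -[1+ _ ] _ _} (*<* ())

-- Only meaningful for N ≥ 1; log 0 is the junk value log 1 = 0.
log : ℕ → ℝ
log N = record
  { L           = λ q → ∃[ n ] q < lowerSum N n
  ; U           = λ q → ∃[ n ] upperSum N n < q
  ; L-inhabited = lowerSum N 0 - 1ℚ , 0 , p-1<p (lowerSum N 0)
  ; U-inhabited = upperSum N 0 + 1ℚ , 0 , p<p+1 (upperSum N 0)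
  ; L-closed    = λ q<r (n , r<s) → n , <-trans q<r r<s
  ; U-closed    = λ q<r (n , s<q) → n , <-trans s<q q<r
  ; L-open      = λ (n , q<s) → let (r , q<r , r<s) = <-dense q<s in r , q<r , n , r<s
  ; U-open      = λ (n , s<r) → let (q , s<q , q<r) = <-dense s<r in q , q<r , n , s<q
  ; disjoint    = λ (m , q<s) (n , t<q) →
      <-irrefl refl (<-≤-trans (<-trans t<q q<s) (lowerSum≤upperSum N m n))
  ; located     = located
  }
  where
  located : ∀ {q r} → q < r → (∃[ n ] q < lowerSum N n) ⊎ (∃[ n ] upperSum N n < r)
  located {q} {r} q<r with archimedean (subst (_< r - q) (+-inverseʳ q) (+-monoˡ-< (- q) q<r))
  ... | n , 1/n<r-q with q <? lowerSum N n
  ...   | yes q<s = inj₁ (n , q<s)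
  ...   | no  q≮s = inj₂ (n , (begin-strict
            upperSum N n           ≤⟨ upperSum≤lowerSum+mesh N n ⟩
            lowerSum N n + recip n ≤⟨ +-monoˡ-≤ (recip n) (≮⇒≥ q≮s) ⟩
            q + recip n            <⟨ +-monoʳ-< q 1/n<r-q ⟩
            q + (r - q)            ≡⟨ solve 2 (λ q r → q :+ (r :- q) := r) refl q r ⟩
            r                      ∎))
    where
    open ≤-Reasoning
    open +-*-Solver

-- f(N) = o(g(N)) as N → ∞, for f eventually nonnegative (there is no
-- absolute value on the left-hand side).
_=o_ : (ℕ → ℝ) → (ℕ → ℝ) → Set
f =o g = ∀ ε .{{_ : Positive ε}} → ∃[ N₀ ] (∀ N → N₀ ℕ.≤ N → f N ≤ᴿ ε · g N)

P⁺ : (n : ℕ) .{{_ : ℕ.NonZero n}} → ℕ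
P⁺ n = max 1 (factors (factorise n))

-- n is a positive integer with P⁺(n) ≤ y
Smooth : ℝ → ℕ → Set
Smooth y n = Σ (ℕ.NonZero n) λ n≢0 → fromℕ (P⁺ n {{n≢0}}) ≤ᴿ y

-- The sets of integers counted by M_k(N, y) and by Ψ(x, y).

SmoothProduct : (k N : ℕ) → ℝ → ℕ → Set
SmoothProduct k N y n =
  Σ (Vec ℕ k) λ xs → All (λ x → x ℕ.≤ N × Smooth y x) xs × foldr′ ℕ._*_ 1 xs ≡ n

SmoothUpTo : ℕ → ℝ → ℕ → Set
SmoothUpTo x y n = n ℕ.≤ x × Smooth y n

-- The set P has exactly m elements.  This is a relation rather than a function
-- of P because membership in the two sets above is not decidable for an
-- arbitrary real y.  Classically each of these finite sets has exactly one
-- cardinality in this sense.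
HasCard : (ℕ → Set) → ℕ → Set
HasCard P m = Σ (List ℕ) λ xs → Unique xs × (∀ n → n ∈ xs ⇔ P n) × length xs ≡ m

{-# OPTIONS --safe #-}

-- Let Y = ⌊y⌋ and X = N ^ k.  Filling factors greedily with primes, every Y-smooth n with
-- n Y ^ k ≤ X is a product of k smooth integers up to N, so only the "shell" of smooth n
-- with X / Y ^ k < n ≤ X can be missed.  To see that the shell is a small part of the set V
-- of all smooth n ≤ X, sum log n = Σ log p over the prime powers p ^ j ∣ n, for n in the
-- shell, and charge the pair (n , p ^ j) to n / p ^ j ∈ V.  Each m ∈ V is charged for a
-- given p only by the j with m p ^ j in the shell, about k log Y / log p of them, so that
--   |shell| · k (log N − log Y)  ≲  π(Y) · k log Y · |V|.
-- By Chebyshev's bound π(Y) log Y = O(Y), and Y = o(log N), the shell has size o(|V|),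
-- uniformly in k.  Logarithms are taken to base 2 and rounded to integers.
module Submission where

module Counting where

  open import Data.List using (List; []; _∷_; _++_; length; map; filter; upTo)
  open import Data.List.Extrema.Nat using (max; argmax-sel; xs≤max; max≤v⁺)
  open import Data.List.Membership.Propositional using (_∈_)
  open import Data.List.Membership.Propositional.Properties
    using (∈-∃++; ∈-++⁺ˡ; ∈-++⁺ʳ; ∈-++⁻; ∈-map⁺; ∈-map⁻; ∈-filter⁺; ∈-filter⁻; ∈-upTo⁺; ∈-upTo⁻; ∈-length)
  open import Data.List.Properties using (length-++; length-map; length-upTo)
  open import Data.List.Relation.Binary.Subset.Propositional using (_⊆_)
  open import Data.List.Relation.Unary.All as All using (All; []; _∷_)
  import Data.List.Relation.Unary.All.Properties as All
  open import Data.List.Relation.Unary.Any using (here; there)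
  open import Data.List.Relation.Unary.Unique.Propositional using (Unique; []; _∷_)
  import Data.List.Relation.Unary.Unique.Propositional.Properties as Unique
  import Data.Integer as ℤ
  import Data.Integer.Properties as ℤ
  open import Data.Nat
  open import Data.Nat.Combinatorics using (_C_; nCk≡n!/k![n-k]!; nCk+nC[k+1]≡[n+1]C[k+1]; [n∸k]!k!∣n!)
  open import Data.Nat.Divisibility
  open import Data.Nat.DivMod using (_/_; _%_; m≡m%n+[m/n]*n; m%n<n; m/n*n≤m; m/n*n≡m)
  open import Data.Nat.ListAction using (sum; product)
  open import Data.Nat.ListAction.Properties using (product-++; ∈⇒∣product)
  open import Data.Nat.Primality
  open import Data.Nat.Primality.Factorisation
  open import Data.Nat.Properties
  open import Data.Nat.Tactic.RingSolver using (solve-∀)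
  open import Data.Product using (Σ; ∃-syntax; _×_; _,_; proj₁; proj₂)
  open import Data.Rational as ℚ using (ℚ; 0ℚ; 1ℚ)
  import Data.Rational.Properties as ℚ
  open import Data.Rational.Solver using (module +-*-Solver)
  import Data.Rational.Unnormalised as ℚᵘ
  import Data.Rational.Unnormalised.Properties as ℚᵘ
  open import Data.Sum using (_⊎_; inj₁; inj₂; [_,_]′)
  open import Data.Vec as Vec using (Vec; []; _∷_)
  open import Data.Vec.Relation.Unary.All as VecAll using ([]; _∷_)
  open import Function using (_∘_; id; module Equivalence)
  open import Relation.Binary.PropositionalEquality
  open import Relation.Nullary using (¬_; Dec; yes; no; contradiction; _×-dec_)
  open import Relation.Nullary.Decidable using (decidable-stable; ¬¬-excluded-middle)
  open import Relation.Unary using (Decidable)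
  open import Defs

  -- Counting in lists

  private variable
    A B : Set

  -- Pigeonhole: the head is cut out of `ys` at a place where it occurs, and the tail, which does
  -- not contain it, still embeds in what is left.
  unique-⊆⇒length-≤ : {xs ys : List A} → Unique xs → xs ⊆ ys → length xs ≤ length ys
  unique-⊆⇒length-≤ {xs = []} _ _ = z≤n
  unique-⊆⇒length-≤ {xs = x ∷ xs} (x∉xs ∷ xs!) sub with ∈-∃++ (sub (here refl))
  ... | as , bs , refl = begin
      suc (length xs)              ≤⟨ s≤s (unique-⊆⇒length-≤ xs! sub′) ⟩
      suc (length (as ++ bs))      ≡⟨ cong suc (length-++ as) ⟩
      suc (length as + length bs)  ≡⟨ +-suc (length as) (length bs) ⟨
      length as + length (x ∷ bs)  ≡⟨ length-++ as ⟨
      length (as ++ x ∷ bs)        ∎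
    where
    open ≤-Reasoning
    sub′ : xs ⊆ as ++ bs
    sub′ z∈xs with ∈-++⁻ as (sub (there z∈xs))
    ... | inj₁ z∈as         = ∈-++⁺ˡ z∈as
    ... | inj₂ (here refl)  = contradiction refl (All.lookup x∉xs z∈xs)
    ... | inj₂ (there z∈bs) = ∈-++⁺ʳ as z∈bs

  count : {P : A → Set} → Decidable P → List A → ℕ
  count P? xs = length (filter P? xs)

  count-mono : {P Q : A → Set} (P? : Decidable P) (Q? : Decidable Q) {xs : List A} → Unique xs →
    (∀ {x} → x ∈ xs → P x → Q x) → count P? xs ≤ count Q? xs
  count-mono P? Q? {xs} xs! P⇒Q = unique-⊆⇒length-≤ (Unique.filter⁺ P? xs!) λ x∈ →
    let (x∈xs , px) = ∈-filter⁻ P? x∈ in ∈-filter⁺ Q? x∈xs (P⇒Q x∈xs px)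

  -- Charges a multiple `n` of `d` to `n / d`, which lies in `V` by closure; the multiples thus lie
  -- in the image of multiplication by `d`.
  count-multiples : {Q : ℕ → Set} (Q? : Decidable Q) {V : List ℕ} → Unique V → ∀ d →
    (∀ m → m * d ∈ V → m ∈ V) →
    count (d ∣?_) (filter Q? V) ≤ count (λ m → Q? (m * d)) V
  count-multiples Q? {V} V! d closed = begin
    count (d ∣?_) (filter Q? V)      ≤⟨ unique-⊆⇒length-≤ (Unique.filter⁺ (d ∣?_) (Unique.filter⁺ Q? V!)) sub ⟩
    length (map (_* d) (filter Qd? V)) ≡⟨ length-map (_* d) (filter Qd? V) ⟩
    count Qd? V                      ∎
    where
    open ≤-Reasoning
    Qd? = λ m → Q? (m * d)
    sub : filter (d ∣?_) (filter Q? V) ⊆ map (_* d) (filter Qd? V)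
    sub n∈ with ∈-filter⁻ (d ∣?_) {xs = filter Q? V} n∈
    ... | n∈′ , divides m refl with ∈-filter⁻ Q? {xs = V} n∈′
    ...   | n∈V , Qn = ∈-map⁺ (_* d) (∈-filter⁺ Qd? (closed m n∈V) Qn)

  -- The distance from an index in `Q` to the largest such index is below `s`, and it determines the
  -- index.
  count-window : {Q : ℕ → Set} (Q? : Decidable Q) (s J : ℕ) → (∀ i j → Q i → Q j → j < i + s) →
    count Q? (upTo J) ≤ s
  count-window {Q = Q} Q? s J close = begin
    length xs                    ≤⟨ unique-⊆⇒length-≤ (Unique.filter⁺ Q? (Unique.upTo⁺ J)) sub ⟩
    length (map (top ∸_) (upTo s)) ≡⟨ length-map (top ∸_) (upTo s) ⟩
    length (upTo s)              ≡⟨ length-upTo s ⟩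
    s                            ∎
    where
    open ≤-Reasoning
    xs = filter Q? (upTo J)
    top = max 0 xs
    top<i+s : ∀ {i} → i ∈ xs → top < i + s
    top<i+s {i} i∈ with argmax-sel id 0 xs
    -- The maximum may be its default `0`, which need not satisfy `Q`; comparing `i` with itself
    -- gives `i < i + s`, hence `0 < i + s`.
    ... | inj₁ top≡0 = subst (_< i + s) (sym top≡0) (≤-<-trans z≤n (close i i Qi Qi))
      where Qi = proj₂ (∈-filter⁻ Q? {xs = upTo J} i∈)
    ... | inj₂ top∈  = close i top (proj₂ (∈-filter⁻ Q? {xs = upTo J} i∈)) (proj₂ (∈-filter⁻ Q? {xs = upTo J} top∈))
    sub : xs ⊆ map (top ∸_) (upTo s)
    sub {i} i∈ = subst (_∈ map (top ∸_) (upTo s)) (m∸[m∸n]≡n i≤top)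
      (∈-map⁺ (top ∸_) (∈-upTo⁺ (+-cancelˡ-< i (top ∸ i) s
        (subst (_< i + s) (sym (m+[n∸m]≡n i≤top)) (top<i+s i∈)))))
      where i≤top = All.lookup (xs≤max 0 xs) i∈

  -- Finite sums and double counting

  ∑ : List A → (A → ℕ) → ℕ
  ∑ xs f = sum (map f xs)

  syntax ∑ xs (λ x → e) = ∑[ x ∈ xs ] e

  ∑-mono : ∀ (xs : List A) {f g : A → ℕ} → (∀ {x} → x ∈ xs → f x ≤ g x) → ∑ xs f ≤ ∑ xs g
  ∑-mono []       f≤g = z≤n
  ∑-mono (x ∷ xs) f≤g = +-mono-≤ (f≤g (here refl)) (∑-mono xs (f≤g ∘ there))

  -- A surplus `c` in the single term at `q` survives in the sum. It serves to record the gain in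
  -- weight when an integer is multiplied by one more prime.
  ∑-mono-+ : ∀ {xs : List A} {f g : A → ℕ} {q c} → q ∈ xs →
    (∀ {x} → x ∈ xs → f x ≤ g x) → c + f q ≤ g q → c + ∑ xs f ≤ ∑ xs g
  ∑-mono-+ {xs = x ∷ xs} {f} {g} {c = c} (here refl) f≤g c+f≤g =
    subst (_≤ ∑ (x ∷ xs) g) (+-assoc c (f x) _) (+-mono-≤ c+f≤g (∑-mono xs (f≤g ∘ there)))
  ∑-mono-+ {xs = x ∷ xs} {f} {g} {c = c} (there q∈) f≤g c+f≤g =
    subst (_≤ ∑ (x ∷ xs) g) (swap (f x) c (∑ xs f))
      (+-mono-≤ (f≤g (here refl)) (∑-mono-+ q∈ (f≤g ∘ there) c+f≤g))
    where
    swap : ∀ a b c → a + (b + c) ≡ b + (a + c)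
    swap = solve-∀

  ∑-const : ∀ (xs : List A) c → ∑[ _ ∈ xs ] c ≡ length xs * c
  ∑-const []       c = refl
  ∑-const (x ∷ xs) c = cong (c +_) (∑-const xs c)

  ∑-+ : ∀ (xs : List A) (f g : A → ℕ) → ∑[ x ∈ xs ] (f x + g x) ≡ ∑ xs f + ∑ xs g
  ∑-+ []       f g = refl
  ∑-+ (x ∷ xs) f g = trans (cong (f x + g x +_) (∑-+ xs f g)) (swap (f x) (g x) _ _)
    where
    swap : ∀ a b c d → a + b + (c + d) ≡ a + c + (b + d)
    swap = solve-∀

  ∑-comm : ∀ (xs : List A) (ys : List B) (f : A → B → ℕ) →
    ∑[ x ∈ xs ] ∑[ y ∈ ys ] f x y ≡ ∑[ y ∈ ys ] ∑[ x ∈ xs ] f x y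
  ∑-comm []       ys f = sym (trans (∑-const ys 0) (*-zeroʳ (length ys)))
  ∑-comm (x ∷ xs) ys f = trans (cong (∑ ys (f x) +_) (∑-comm xs ys f))
    (sym (∑-+ ys (f x) (λ y → ∑[ x ∈ xs ] f x y)))

  ∑-*ˡ : ∀ c (xs : List A) (f : A → ℕ) → ∑[ x ∈ xs ] (c * f x) ≡ c * ∑ xs f
  ∑-*ˡ c []       f = sym (*-zeroʳ c)
  ∑-*ˡ c (x ∷ xs) f = trans (cong (c * f x +_) (∑-*ˡ c xs f)) (sym (*-distribˡ-+ c (f x) _))

  -- Both sides are the number of related pairs, counted by rows and by columns.
  ∑-count-comm : ∀ {R : A → B → Set} (R? : ∀ x y → Dec (R x y)) xs ys →
    ∑[ x ∈ xs ] count (R? x) ys ≡ ∑[ y ∈ ys ] count (λ x → R? x y) xs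
  ∑-count-comm R? []       ys = sym (trans (∑-const ys 0) (*-zeroʳ (length ys)))
  ∑-count-comm R? (x ∷ xs) ys = trans (cong (count (R? x) ys +_) (∑-count-comm R? xs ys)) (step ys)
    where
    swap : ∀ a b c → a + (b + c) ≡ b + (a + c)
    swap = solve-∀
    step : ∀ ys → count (R? x) ys + ∑[ y ∈ ys ] count (λ x → R? x y) xs
                ≡ ∑[ y ∈ ys ] count (λ x → R? x y) (x ∷ xs)
    step []       = refl
    step (y ∷ ys) with R? x y
    ... | yes _ = cong suc (trans (swap rowx coly rest) (cong (coly +_) (step ys)))
      where
      rowx = count (R? x) ys
      coly = count (λ x → R? x y) xs
      rest = ∑[ y ∈ ys ] count (λ x → R? x y) xs
    ... | no  _ = trans (swap rowx coly rest) (cong (coly +_) (step ys))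
      where
      rowx = count (R? x) ys
      coly = count (λ x → R? x y) xs
      rest = ∑[ y ∈ ys ] count (λ x → R? x y) xs

  -- Smooth integers and the shell

  PrimeUpTo : ℕ → ℕ → Set
  PrimeUpTo Y q = Prime q × q ≤ Y

  _-smooth_ : ℕ → ℕ → Set
  Y -smooth n = ∀ {p} → Prime p → p ∣ n → p ≤ Y

  product-smooth : ∀ {Y qs} → All (PrimeUpTo Y) qs → Y -smooth product qs
  product-smooth {qs = qs} ps p-prime p∣ = proj₂ (All.lookup ps
    (factorisationHasAllPrimeFactors p-prime p∣ (All.map proj₁ ps)))

  smooth-factors : ∀ {Y} n .{{_ : NonZero n}} → Y -smooth n →
    ∃[ qs ] All (PrimeUpTo Y) qs × product qs ≡ n
  smooth-factors {Y} n smooth = factors f , All.tabulate good , sym isFactorisation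
    where
    f = factorise n
    open PrimeFactorisation f using (isFactorisation; factorsPrime)
    good : ∀ {q} → q ∈ factors f → PrimeUpTo Y q
    good {q} q∈ = All.lookup factorsPrime q∈ ,
      smooth (All.lookup factorsPrime q∈) (subst (q ∣_) (sym isFactorisation) (∈⇒∣product q∈))

  -- Takes factors while the product stays within `N`. If it stops early, the next factor, at most
  -- `Y`, would push the product beyond `N`; this is the second alternative.
  greedy : ∀ {Y N} a qs → a ≤ N → All (_≤ Y) qs → ∃[ as ] ∃[ bs ]
    qs ≡ as ++ bs × a * product as ≤ N × (bs ≡ [] ⊎ N < a * product as * Y)
  greedy a [] a≤N [] = [] , [] , refl , ≤-trans (≤-reflexive (*-identityʳ a)) a≤N , inj₁ refl
  greedy {Y} {N} a (q ∷ qs) a≤N (q≤Y ∷ qs≤Y) with a * q ≤? N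
  ... | no  aq≰N = [] , q ∷ qs , refl , ≤-trans (≤-reflexive (*-identityʳ a)) a≤N ,
    inj₂ (<-≤-trans (≰⇒> aq≰N) (*-mono-≤ (≤-reflexive (sym (*-identityʳ a))) q≤Y))
  ... | yes aq≤N with greedy (a * q) qs aq≤N qs≤Y
  ...   | as , bs , refl , as≤N , end rewrite *-assoc a q (product as) =
    q ∷ as , bs , refl , as≤N , end

  -- Each factor but the last is filled until it exceeds N / Y.
  pack : ∀ {Y N} .{{_ : NonZero N}} → Y ≤ N → ∀ k qs → All (PrimeUpTo Y) qs →
    product qs * Y ^ k ≤ N ^ k →
    Σ (Vec ℕ k) λ xs →
    VecAll.All (λ x → x ≤ N × NonZero x × Y -smooth x) xs × Vec.foldr′ _*_ 1 xs ≡ product qs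
  pack Y≤N zero qs ps Πqs≤ = [] , [] ,
    ≤-antisym (productOfPrimes≥1 (All.map proj₁ ps)) (subst (_≤ 1) (*-identityʳ _) Πqs≤)
  pack {Y} {N} Y≤N (suc k) qs ps Πqs≤ with greedy 1 qs (>-nonZero⁻¹ N) (All.map proj₂ ps)
  ... | as , bs , refl , as≤N , end with All.++⁻ as ps
  ... | as-ps , bs-ps with pack Y≤N k bs bs-ps (rest end)
    where
    rest : bs ≡ [] ⊎ N < 1 * product as * Y → product bs * Y ^ k ≤ N ^ k
    -- No primes are left, so the product is `1`, and `Y ≤ N` alone keeps the size condition for the
    -- remaining entries.
    rest (inj₁ refl) = subst (_≤ N ^ k) (sym (*-identityˡ (Y ^ k))) (^-monoˡ-≤ k Y≤N)
    rest (inj₂ N<)   = *-cancelˡ-≤ N (begin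
      N * (product bs * Y ^ k)                  ≤⟨ *-monoˡ-≤ (product bs * Y ^ k) (<⇒≤ N<) ⟩
      1 * product as * Y * (product bs * Y ^ k) ≡⟨ regroup (product as) (product bs) Y (Y ^ k) ⟩
      product as * product bs * (Y * Y ^ k)     ≡⟨ cong (_* (Y * Y ^ k)) (product-++ as bs) ⟨
      product (as ++ bs) * (Y * Y ^ k)          ≤⟨ Πqs≤ ⟩
      N * N ^ k                                 ∎)
      where
      open ≤-Reasoning
      regroup : ∀ a b c d → 1 * a * c * (b * d) ≡ a * b * (c * d)
      regroup = solve-∀
  ... | xs , xs-good , Πxs≡ = product as ∷ xs ,
    (subst (_≤ N) (*-identityˡ _) as≤N , productOfPrimes≢0 (All.map proj₁ as-ps) , product-smooth as-ps) ∷ xs-good ,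
    trans (cong (product as *_) Πxs≡) (sym (product-++ as bs))

  -- Binary logarithms, rounded down, with default `lg 0 = 0`

  lg : ℕ → ℕ
  lg zero    = 0
  lg (suc n) with suc n <? 2 ^ suc (lg n)
  ... | yes _ = lg n
  ... | no  _ = suc (lg n)

  n<2^[1+lg] : ∀ n → n < 2 ^ suc (lg n)
  n<2^[1+lg] zero    = z<s
  n<2^[1+lg] (suc n) with suc n <? 2 ^ suc (lg n)
  ... | yes n< = n<
  ... | no  _  = ≤-<-trans (n<2^[1+lg] n) (^-monoʳ-< 2 (s<s z<s) (n<1+n (suc (lg n))))

  2^lg≤n : ∀ n .{{_ : NonZero n}} → 2 ^ lg n ≤ n
  2^lg≤n (suc n) with suc n <? 2 ^ suc (lg n)
  2^lg≤n (suc zero)      | yes _  = ≤-refl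
  2^lg≤n (suc n@(suc _)) | yes _  = m≤n⇒m≤1+n (2^lg≤n n)
  2^lg≤n (suc n)         | no  n≮ = ≮⇒≥ n≮

  2^-cancel-< : ∀ {m n} → 2 ^ m < 2 ^ n → m < n
  2^-cancel-< {m} {n} lt with m <? n
  ... | yes m<n = m<n
  ... | no  m≮n = contradiction (^-monoʳ-≤ 2 (≮⇒≥ m≮n)) (<⇒≱ lt)

  n<2^n : ∀ n → n < 2 ^ n
  n<2^n zero    = z<s
  n<2^n (suc n) = begin-strict
    suc n         ≤⟨ n<2^n n ⟩
    2 ^ n         <⟨ ^-monoʳ-< 2 (s<s z<s) (n<1+n n) ⟩
    2 ^ suc n     ∎
    where open ≤-Reasoning

  -- Prime valuations and a rounded logarithm of a smooth integer

  primes : ℕ → List ℕ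
  primes Y = filter prime? (upTo (suc Y))

  ∈-primes⁺ : ∀ {Y p} → Prime p → p ≤ Y → p ∈ primes Y
  ∈-primes⁺ pr p≤Y = ∈-filter⁺ prime? (∈-upTo⁺ (s≤s p≤Y)) pr

  ∈-primes⁻ : ∀ {Y p} → p ∈ primes Y → PrimeUpTo Y p
  ∈-primes⁻ {Y} p∈ = let (p∈′ , pr) = ∈-filter⁻ prime? {xs = upTo (suc Y)} p∈ in pr , s≤s⁻¹ (∈-upTo⁻ p∈′)

  prime⇒≥2 : ∀ {p} → Prime p → 2 ≤ p
  prime⇒≥2 {p} pr = nonTrivial⇒n>1 p {{prime⇒nonTrivial pr}}

  -- The p-adic valuation of n, provided that n < p ^ J.
  val : ℕ → ℕ → ℕ → ℕ
  val J p n = count (λ j → p ^ suc j ∣? n) (upTo J)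

  -- The logarithm to base 2 rounded up, in the sense that `p < 2 ^ bits p`.
  bits : ℕ → ℕ
  bits p = suc (lg p)

  -- For `Y`-smooth `n`, an upper approximation to log₂ n = Σ v_p(n) log₂ p; `J` caps the exponents
  -- that are tested.
  logWeight : ℕ → ℕ → ℕ → ℕ
  logWeight Y J n = ∑[ p ∈ primes Y ] (bits p * val J p n)

  val-mono-∣ : ∀ J p {m n} → m ∣ n → val J p m ≤ val J p n
  val-mono-∣ J p m∣n = count-mono _ _ (Unique.upTo⁺ J) λ _ p∣m → ∣-trans p∣m m∣n

  -- Each index `j` counted for `n` yields `suc j` for `q * n`, and index `0` is new.
  val-*ˡ : ∀ {J q n} → 2 ≤ q → .{{_ : NonZero n}} → n < 2 ^ J → suc (val J q n) ≤ val J q (q * n)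
  val-*ˡ {J} {q} {n} 2≤q n<2^J = begin
    suc (length js)          ≡⟨ cong suc (length-map suc js) ⟨
    length (0 ∷ map suc js)  ≤⟨ unique-⊆⇒length-≤ (All.tabulate 0∉ ∷ Unique.map⁺ suc-injective js!) sub ⟩
    val J q (q * n)          ∎
    where
    open ≤-Reasoning
    q^j∣?n = λ j → q ^ suc j ∣? n
    q^j∣?qn = λ j → q ^ suc j ∣? q * n
    js = filter q^j∣?n (upTo J)
    js! = Unique.filter⁺ q^j∣?n (Unique.upTo⁺ J)
    0∉ : ∀ {j} → j ∈ map suc js → ¬ 0 ≡ j
    0∉ j∈ refl with ∈-map⁻ suc j∈
    ... | _ , _ , ()
    -- From 2^j ≤ q^j ≤ n < 2^J: the shifted indices stay within the tested range.
    j<J : ∀ j → q ^ j ∣ n → j < J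
    j<J j q^j∣n = 2^-cancel-< (≤-<-trans (≤-trans (^-monoˡ-≤ j 2≤q) (∣⇒≤ q^j∣n)) n<2^J)
    sub : 0 ∷ map suc js ⊆ filter q^j∣?qn (upTo J)
    sub (here refl) = ∈-filter⁺ q^j∣?qn (∈-upTo⁺ (j<J 0 (1∣ n)))
      (∣-trans (∣-reflexive (*-identityʳ q)) (m∣m*n n))
    sub (there j∈) with ∈-map⁻ suc j∈
    ... | j , j∈js , refl with ∈-filter⁻ q^j∣?n {xs = upTo J} j∈js
    ...   | _ , q^j∣n = ∈-filter⁺ q^j∣?qn (∈-upTo⁺ (j<J (suc j) q^j∣n)) (*-monoʳ-∣ q q^j∣n)

  -- Induction on the prime factors: each further factor `q`, new or repeated, raises its own
  -- valuation and so adds at least `bits q` to the weight, while the product grows by less than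
  -- `2 ^ bits q`.
  product≤2^logWeight : ∀ {Y} J qs → All (PrimeUpTo Y) qs → product qs < 2 ^ J →
    product qs ≤ 2 ^ logWeight Y J (product qs)
  product≤2^logWeight {Y} J [] [] _ = m^n>0 2 (logWeight Y J 1)
  product≤2^logWeight {Y} J (q ∷ qs) ((pr , q≤Y) ∷ ps) qn<2^J = begin
    q * n                               ≤⟨ *-mono-≤ (<⇒≤ (n<2^[1+lg] q)) (product≤2^logWeight J qs ps n<2^J) ⟩
    2 ^ bits q * 2 ^ logWeight Y J n    ≡⟨ ^-distribˡ-+-* 2 (bits q) (logWeight Y J n) ⟨
    2 ^ (bits q + logWeight Y J n)
      ≤⟨ ^-monoʳ-≤ 2 (∑-mono-+ {f = λ p → bits p * val J p n} {c = bits q} (∈-primes⁺ pr q≤Y) mono step) ⟩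
    2 ^ logWeight Y J (q * n)           ∎
    where
    open ≤-Reasoning
    n = product qs
    instance
      n≢0 : NonZero n
      n≢0 = productOfPrimes≢0 (All.map proj₁ ps)
      q≢0 : NonZero q
      q≢0 = prime⇒nonZero pr
    n<2^J : n < 2 ^ J
    n<2^J = ≤-<-trans (m≤n*m n q) qn<2^J
    mono : ∀ {p} → p ∈ primes Y → bits p * val J p n ≤ bits p * val J p (q * n)
    mono {p} _ = *-monoʳ-≤ (bits p) (val-mono-∣ J p (n∣m*n q))
    step : bits q + bits q * val J q n ≤ bits q * val J q (q * n)
    step = subst (_≤ bits q * val J q (q * n)) (*-suc (bits q) (val J q n))
      (*-monoʳ-≤ (bits q) (val-*ˡ {J} (prime⇒≥2 pr) n<2^J))

  n≤2^logWeight : ∀ {Y} J n .{{_ : NonZero n}} → Y -smooth n → n < 2 ^ J → n ≤ 2 ^ logWeight Y J n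
  n≤2^logWeight J n smooth n<2^J with smooth-factors n smooth
  ... | qs , ps , refl = product≤2^logWeight J qs ps n<2^J

  -- The factor 4 absorbs the rounding of log₂ p up to bits p and of t / log₂ p up to s.
  span : ∀ {p b t} → Prime p → p < 2 ^ b → b ≤ t →
    ∃[ s ] 2 ^ t ≤ p ^ s × bits p * s ≤ 4 * t
  span {p} {b} {t} pr p<2^b b≤t = s , 2^t≤p^s , bound
    where
    open ≤-Reasoning
    e = lg p
    2^e≤p : 2 ^ e ≤ p
    2^e≤p = 2^lg≤n p {{prime⇒nonZero pr}}
    1≤e : 1 ≤ e
    1≤e = s≤s⁻¹ (2^-cancel-< {1} (≤-<-trans (prime⇒≥2 pr) (n<2^[1+lg] p)))
    instance
      e≢0 : NonZero e
      e≢0 = >-nonZero 1≤e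
    e≤t : e ≤ t
    e≤t = ≤-trans (<⇒≤ (2^-cancel-< (≤-<-trans 2^e≤p p<2^b))) b≤t
    s = suc (t / e)
    t≤es : t ≤ e * s
    t≤es = begin
      t                     ≡⟨ m≡m%n+[m/n]*n t e ⟩
      t % e + t / e * e     ≤⟨ +-monoˡ-≤ (t / e * e) (<⇒≤ (m%n<n t e)) ⟩
      s * e                 ≡⟨ *-comm s e ⟩
      e * s                 ∎
    2^t≤p^s : 2 ^ t ≤ p ^ s
    2^t≤p^s = begin
      2 ^ t        ≤⟨ ^-monoʳ-≤ 2 t≤es ⟩
      2 ^ (e * s)  ≡⟨ ^-*-assoc 2 e s ⟨
      (2 ^ e) ^ s  ≤⟨ ^-monoˡ-≤ s 2^e≤p ⟩
      p ^ s        ∎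
    bound : bits p * s ≤ 4 * t
    bound = begin
      (1 + e) * s              ≤⟨ *-monoˡ-≤ s (+-monoˡ-≤ e 1≤e) ⟩
      (e + e) * s              ≡⟨ regroup e (t / e) ⟩
      2 * (e + t / e * e)      ≤⟨ *-monoʳ-≤ 2 (+-mono-≤ e≤t (m/n*n≤m t e)) ⟩
      2 * (t + t)              ≡⟨ four t ⟩
      4 * t                    ∎
      where
      regroup : ∀ e q → (e + e) * suc q ≡ 2 * (e + q * e)
      regroup = solve-∀
      four : ∀ t → 2 * (t + t) ≡ 4 * t
      four = solve-∀

  -- Charging the shell to the set of all smooth integers

  module Shell
    {X D J : ℕ} {V : List ℕ} (V! : Unique V) (V-closed : ∀ m d → m * d ∈ V → m ∈ V)
    where

    -- The interval X / D < n ≤ X without division; it is applied with X = N^k and D = Y^k.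
    InShell : ℕ → Set
    InShell n = X < n * D × n ≤ X

    inShell? : Decidable InShell
    inShell? n = X <? n * D ×-dec n ≤? X

    shell : List ℕ
    shell = filter inShell? V

    -- Each pair (n , j) with p ^ (1 + j) ∣ n is charged to the quotient n / p ^ (1 + j).
    ∑val-shell : ∀ p s → D ≤ p ^ s → ∑[ n ∈ shell ] val J p n ≤ length V * s
    ∑val-shell p s D≤p^s = begin
      ∑[ n ∈ shell ] count (λ j → p ^ suc j ∣? n) js              ≡⟨ ∑-count-comm (λ n j → p ^ suc j ∣? n) shell js ⟩
      ∑[ j ∈ js ] count (p ^ suc j ∣?_) shell
        ≤⟨ ∑-mono js (λ {j} _ → count-multiples inShell? V! (p ^ suc j) (λ m → V-closed m (p ^ suc j))) ⟩
      ∑[ j ∈ js ] count (λ m → inShell? (m * p ^ suc j)) V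
        ≡⟨ ∑-count-comm (λ m j → inShell? (m * p ^ suc j)) V js ⟨
      ∑[ m ∈ V ] count (λ j → inShell? (m * p ^ suc j)) js
        ≤⟨ ∑-mono V (λ {m} _ → count-window (λ j → inShell? (m * p ^ suc j)) s J (window m)) ⟩
      ∑[ m ∈ V ] s                                                ≡⟨ ∑-const V s ⟩
      length V * s                                                ∎
      where
      open ≤-Reasoning
      js = upTo J
      -- The ends of the shell differ by the factor D ≤ p^s, so a further `s` powers of `p` lead
      -- from inside the shell past `X`.
      window : ∀ m i j → InShell (m * p ^ suc i) → InShell (m * p ^ suc j) → j < i + s
      window m i j (X<mpᵢD , _) (_ , mpⱼ≤X) with j <? i + s
      ... | yes j< = j<
      ... | no  j≮ with m≤n⇒∃[o]m+o≡n (≮⇒≥ j≮)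
      ...   | o , refl = contradiction X<mpᵢD (≤⇒≯ (begin
        m * p ^ suc i * D                   ≤⟨ *-monoʳ-≤ (m * p ^ suc i) D≤p^s ⟩
        m * p ^ suc i * p ^ s               ≡⟨ *-assoc m (p ^ suc i) (p ^ s) ⟩
        m * (p ^ suc i * p ^ s)             ≡⟨ cong (m *_) (^-distribˡ-+-* p (suc i) s) ⟨
        m * p ^ (suc i + s)                 ≤⟨ *-monoʳ-≤ m (^-monoʳ-≤ p {{p≢0}} (m≤m+n (suc i + s) o)) ⟩
        m * p ^ suc (i + s + o)             ≤⟨ mpⱼ≤X ⟩
        X                                   ∎))
        where
        p≢0 : NonZero p
        p≢0 = ≢-nonZero λ { refl → contradiction (subst (X <_) (cong (_* D) (*-zeroʳ m)) X<mpᵢD) n≮0 }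

    -- After the interchange of sums, a prime `p` costs `bits p` times a window of about t / log₂ p
    -- exponents. The logarithms of `p` cancel, leaving the same bound for every prime.
    ∑logWeight-shell : ∀ {Y b t} → Y < 2 ^ b → b ≤ t → D ≤ 2 ^ t →
      ∑[ n ∈ shell ] logWeight Y J n ≤ length (primes Y) * (4 * t * length V)
    ∑logWeight-shell {Y} {b} {t} Y<2^b b≤t D≤2^t = begin
      ∑[ n ∈ shell ] ∑[ p ∈ primes Y ] (bits p * val J p n)
        ≡⟨ ∑-comm shell (primes Y) (λ n p → bits p * val J p n) ⟩
      ∑[ p ∈ primes Y ] ∑[ n ∈ shell ] (bits p * val J p n)   ≤⟨ ∑-mono (primes Y) perPrime ⟩
      ∑[ p ∈ primes Y ] (4 * t * length V)                    ≡⟨ ∑-const (primes Y) (4 * t * length V) ⟩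
      length (primes Y) * (4 * t * length V)                  ∎
      where
      open ≤-Reasoning
      perPrime : ∀ {p} → p ∈ primes Y → ∑[ n ∈ shell ] (bits p * val J p n) ≤ 4 * t * length V
      perPrime {p} p∈ with ∈-primes⁻ p∈
      ... | pr , p≤Y with span pr (≤-<-trans p≤Y Y<2^b) b≤t
      ...   | s , 2^t≤p^s , bits*s≤4t = begin
        ∑[ n ∈ shell ] (bits p * val J p n)   ≡⟨ ∑-*ˡ (bits p) shell (val J p) ⟩
        bits p * ∑ shell (val J p)            ≤⟨ *-monoʳ-≤ (bits p) (∑val-shell p s (≤-trans D≤2^t 2^t≤p^s)) ⟩
        bits p * (length V * s)               ≡⟨ regroup (bits p) (length V) s ⟩
        bits p * s * length V                 ≤⟨ *-monoˡ-≤ (length V) bits*s≤4t ⟩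
        4 * t * length V                      ∎
        where
        regroup : ∀ a b c → a * (b * c) ≡ a * c * b
        regroup = solve-∀

  -- A shell element satisfies n Y^k > N^k, so its weight is at least k (L - b). Summing over the
  -- shell, comparing with the charging bound at t = b k and cancelling `k` makes the estimate
  -- uniform in `k`.
  shell-bound : ∀ {N Y k b L} {V : List ℕ} .{{_ : NonZero k}}
    (V! : Unique V) (V-closed : ∀ m d → m * d ∈ V → m ∈ V) →
    (∀ {n} → n ∈ V → NonZero n × Y -smooth n) → Y < 2 ^ b → 2 ^ L ≤ N →
    let S = length (Shell.shell {N ^ k} {Y ^ k} {N ^ k} V! V-closed) in
    S * L ≤ 4 * (b * length (primes Y)) * length V + S * b
  shell-bound {N} {Y} {k} {b} {L} {V} V! V-closed V-smooth Y<2^b 2^L≤N = *-cancelʳ-≤ _ _ k (begin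
    S * L * k                                           ≡⟨ *-assoc S L k ⟩
    S * (L * k)                                         ≡⟨ ∑-const shell (L * k) ⟨
    ∑[ n ∈ shell ] (L * k)                              ≤⟨ ∑-mono shell Lk≤ ⟩
    ∑[ n ∈ shell ] (logWeight Y X n + b * k)            ≡⟨ ∑-+ shell (logWeight Y X) (λ _ → b * k) ⟩
    ∑ shell (logWeight Y X) + ∑[ n ∈ shell ] (b * k)    ≡⟨ cong (∑ shell (logWeight Y X) +_) (∑-const shell (b * k)) ⟩
    ∑ shell (logWeight Y X) + S * (b * k)
      ≤⟨ +-monoˡ-≤ (S * (b * k)) (∑logWeight-shell {Y} {b} Y<2^b (m≤m*n b k) D≤) ⟩
    π * (4 * (b * k) * length V) + S * (b * k)          ≡⟨ regroup π b k (length V) S ⟩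
    (4 * (b * π) * length V + S * b) * k                ∎)
    where
    open ≤-Reasoning
    X = N ^ k
    -- The exponent cap is `X` itself, which suffices since n ≤ X < 2^X.
    open Shell {X} {Y ^ k} {X} V! V-closed
    S = length shell
    π = length (primes Y)
    D≤ : Y ^ k ≤ 2 ^ (b * k)
    D≤ = ≤-trans (^-monoˡ-≤ k (<⇒≤ Y<2^b)) (≤-reflexive (^-*-assoc 2 b k))
    Lk≤ : ∀ {n} → n ∈ shell → L * k ≤ logWeight Y X n + b * k
    Lk≤ {n} n∈ with ∈-filter⁻ inShell? {xs = V} n∈
    ... | n∈V , X<nD , n≤X with V-smooth n∈V
    ...   | n≢0 , smooth = <⇒≤ (2^-cancel-< (begin-strict
      2 ^ (L * k)                              ≡⟨ ^-*-assoc 2 L k ⟨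
      (2 ^ L) ^ k                              ≤⟨ ^-monoˡ-≤ k 2^L≤N ⟩
      X                                        <⟨ X<nD ⟩
      n * Y ^ k
        ≤⟨ *-mono-≤ (n≤2^logWeight X n {{n≢0}} smooth (≤-<-trans n≤X (n<2^n X))) D≤ ⟩
      2 ^ logWeight Y X n * 2 ^ (b * k)        ≡⟨ ^-distribˡ-+-* 2 (logWeight Y X n) (b * k) ⟨
      2 ^ (logWeight Y X n + b * k)            ∎))
    regroup : ∀ π b k v S → π * (4 * (b * k) * v) + S * (b * k) ≡ (4 * (b * π) * v + S * b) * k
    regroup = solve-∀

  -- Chebyshev's bound

  nCk≤2^n : ∀ n k → n C k ≤ 2 ^ n
  nCk≤2^n zero    zero    = ≤-refl
  nCk≤2^n zero    (suc k) = z≤n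
  nCk≤2^n (suc n) zero    = m^n>0 2 (suc n)
  nCk≤2^n (suc n) (suc k) = begin
    suc n C suc k          ≡⟨ nCk+nC[k+1]≡[n+1]C[k+1] n k ⟨
    n C k + n C suc k      ≤⟨ +-mono-≤ (nCk≤2^n n k) (nCk≤2^n n (suc k)) ⟩
    2 ^ n + 2 ^ n          ≡⟨ cong (2 ^ n +_) (+-identityʳ (2 ^ n)) ⟨
    2 ^ suc n              ∎
    where open ≤-Reasoning

  centralBinomial-! : ∀ n → ((2 * n) C n) * (n ! * n !) ≡ (2 * n) !
  centralBinomial-! n = begin
    ((2 * n) C n) * (n ! * n !)                            ≡⟨ cong (λ m → ((2 * n) C n) * (n ! * m !)) 2n∸n≡n ⟨
    ((2 * n) C n) * (n ! * (2 * n ∸ n) !)                  ≡⟨ cong (_* (n ! * (2 * n ∸ n) !)) (nCk≡n!/k![n-k]! n≤2n) ⟩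
    (2 * n) ! / (n ! * (2 * n ∸ n) !) * (n ! * (2 * n ∸ n) !)
      ≡⟨ m/n*n≡m (subst (_∣ (2 * n) !) (*-comm ((2 * n ∸ n) !) (n !)) ([n∸k]!k!∣n! n≤2n)) ⟩
    (2 * n) !                                            ∎
    where
    open ≡-Reasoning
    instance
      _ = n !* (2 * n ∸ n) !≢0
    n≤2n : n ≤ 2 * n
    n≤2n = m≤m+n n (n + 0)
    2n∸n≡n : 2 * n ∸ n ≡ n
    2n∸n≡n = trans (m+n∸m≡n n (n + 0)) (+-identityʳ n)

  prime∣!⇒≤ : ∀ {p} n → Prime p → p ∣ n ! → p ≤ n
  prime∣!⇒≤ zero    pr p∣1 = contradiction (subst Prime (∣1⇒≡1 p∣1) pr) ¬prime[1]
  prime∣!⇒≤ (suc n) pr p∣n! with euclidsLemma (suc n) (n !) pr p∣n!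
  ... | inj₁ p∣1+n = ∣⇒≤ p∣1+n
  ... | inj₂ p∣n!′ = m≤n⇒m≤1+n (prime∣!⇒≤ n pr p∣n!′)

  -- Such a prime divides (2n)! but not n! n!, whose prime factors are at most `n`.
  prime∣centralBinomial : ∀ {p n} → Prime p → n < p → p ≤ 2 * n → p ∣ (2 * n) C n
  prime∣centralBinomial {p} {n} pr n<p p≤2n
    with euclidsLemma ((2 * n) C n) (n ! * n !) pr
           (subst (p ∣_) (sym (centralBinomial-! n)) (∣-trans (∣n! p pr) (m≤n⇒m!∣n! p≤2n)))
    where
    ∣n! : ∀ p → Prime p → p ∣ p !
    ∣n! zero    pr = contradiction pr ¬prime[0]
    ∣n! (suc p) _  = m∣m*n (p !)
  ... | inj₁ p∣C = p∣C
  ... | inj₂ p∣n!n! with euclidsLemma (n !) (n !) pr p∣n!n!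
  ...   | inj₁ p∣n! = contradiction (prime∣!⇒≤ n pr p∣n!) (<⇒≱ n<p)
  ...   | inj₂ p∣n! = contradiction (prime∣!⇒≤ n pr p∣n!) (<⇒≱ n<p)

  -- With m = q Πps, Euclid's lemma puts `p` into `q`; dividing `Πps` would make `p` a repetition of
  -- one of the `ps`.
  product-primes-∣ : ∀ {m ps} → Unique ps → All Prime ps → All (_∣ m) ps → product ps ∣ m
  product-primes-∣ {m} [] [] [] = 1∣ m
  product-primes-∣ {ps = p ∷ ps} (p∉ps ∷ ps!) (pr ∷ prs) (p∣m ∷ ps∣m)
    with product-primes-∣ ps! prs ps∣m
  ... | divides q refl with euclidsLemma q (product ps) pr p∣m
  ...   | inj₁ p∣q  = *-monoˡ-∣ (product ps) p∣q
  ...   | inj₂ p∣Πps = contradiction refl (All.lookup p∉ps (factorisationHasAllPrimeFactors pr p∣Πps prs))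

  ^-length≤product : ∀ {n} ps → All (n ≤_) ps → n ^ length ps ≤ product ps
  ^-length≤product []       []           = ≤-refl
  ^-length≤product (p ∷ ps) (n≤p ∷ n≤ps) = *-mono-≤ n≤p (^-length≤product ps n≤ps)

  -- The primes in (n , 2n] divide the central binomial coefficient, which is at most 4 ^ n.
  primes-doubling : ∀ j → j * length (primes (2 * 2 ^ j)) ≤ j * length (primes (2 ^ j)) + 2 * 2 ^ j
  primes-doubling j = begin
    j * length (primes (2 * n))
      ≤⟨ *-monoʳ-≤ j (unique-⊆⇒length-≤ (Unique.filter⁺ prime? (Unique.upTo⁺ (suc (2 * n)))) sub) ⟩
    j * length (primes n ++ new)               ≡⟨ cong (j *_) (length-++ (primes n)) ⟩
    j * (length (primes n) + length new)       ≡⟨ *-distribˡ-+ j (length (primes n)) (length new) ⟩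
    j * length (primes n) + j * length new     ≤⟨ +-monoʳ-≤ (j * length (primes n)) (2^-cancel-≤ 2^≤) ⟩
    j * length (primes n) + 2 * n              ∎
    where
    open ≤-Reasoning
    n = 2 ^ j
    new = filter (n <?_) (primes (2 * n))
    sub : primes (2 * n) ⊆ primes n ++ new
    sub {p} p∈ with p ≤? n
    ... | yes p≤n = ∈-++⁺ˡ (∈-primes⁺ (proj₁ (∈-primes⁻ {2 * n} p∈)) p≤n)
    ... | no  p≰n = ∈-++⁺ʳ (primes n) (∈-filter⁺ (n <?_) p∈ (≰⇒> p≰n))
    2^-cancel-≤ : ∀ {a b} → 2 ^ a ≤ 2 ^ b → a ≤ b
    2^-cancel-≤ {a} {b} le = s≤s⁻¹ (2^-cancel-< {a} {suc b} (≤-<-trans le (^-monoʳ-< 2 (s<s z<s) (n<1+n b))))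
    new-prime : All (λ p → Prime p × n < p × p ≤ 2 * n) new
    new-prime = All.tabulate λ p∈ →
      let (p∈′ , n<p) = ∈-filter⁻ (n <?_) {xs = primes (2 * n)} p∈
          (pr , p≤2n) = ∈-primes⁻ p∈′
      in pr , n<p , p≤2n
    C≢0 : NonZero ((2 * n) C n)
    C≢0 = m*n≢0⇒m≢0 ((2 * n) C n) {{subst NonZero (sym (centralBinomial-! n)) ((2 * n) !≢0)}}
    2^≤ : 2 ^ (j * length new) ≤ 2 ^ (2 * n)
    2^≤ = begin
      2 ^ (j * length new)    ≡⟨ ^-*-assoc 2 j (length new) ⟨
      n ^ length new          ≤⟨ ^-length≤product new (All.map (<⇒≤ ∘ proj₁ ∘ proj₂) new-prime) ⟩
      product new             ≤⟨ ∣⇒≤ {{C≢0}} (product-primes-∣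
                                   (Unique.filter⁺ (n <?_) (Unique.filter⁺ prime? (Unique.upTo⁺ (suc (2 * n)))))
                                   (All.map proj₁ new-prime)
                                   (All.map (λ (pr , n<p , p≤2n) → prime∣centralBinomial pr n<p p≤2n) new-prime)) ⟩
      (2 * n) C n             ≤⟨ nCk≤2^n (2 * n) n ⟩
      2 ^ (2 * n)             ∎

  -- Induction by doubling. The step needs 6 (k + 1) ≤ 8 k, that is k ≥ 3, so the exponents up to 3
  -- are checked by evaluation.
  chebyshev : ∀ k → k * length (primes (2 ^ k)) ≤ 4 * 2 ^ k
  chebyshev 0 = z≤n
  chebyshev 1 = s≤s z≤n
  chebyshev 2 = s≤s (s≤s (s≤s (s≤s z≤n)))
  chebyshev 3 = m≤m+n 12 20
  chebyshev (suc k@(suc (suc (suc i)))) = *-cancelˡ-≤ k (begin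
    k * (suc k * π′)                   ≡⟨ swap k π′ ⟩
    suc k * (k * π′)                   ≤⟨ *-monoʳ-≤ (suc k) (primes-doubling k) ⟩
    suc k * (k * π + 2 * n)            ≤⟨ *-monoʳ-≤ (suc k) (+-monoˡ-≤ (2 * n) (chebyshev k)) ⟩
    suc k * (4 * n + 2 * n)            ≤⟨ m≤m+n (suc k * (4 * n + 2 * n)) (i * (2 * n)) ⟩
    (4 + i) * (4 * n + 2 * n) + i * (2 * n) ≡⟨ regroup i n ⟩
    k * (4 * (2 * n))                  ∎)
    where
    open ≤-Reasoning
    n = 2 ^ k
    π = length (primes n)
    π′ = length (primes (2 * n))
    swap : ∀ k x → k * (suc k * x) ≡ suc k * (k * x)
    swap = solve-∀
    regroup : ∀ i n → (4 + i) * (4 * n + 2 * n) + i * (2 * n) ≡ (3 + i) * (4 * (2 * n))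
    regroup = solve-∀

  -- Chebyshev's bound at the power of two just above `Y`, which is at most 2 Y; this turns the
  -- constant 4 into 8.
  primes-bound : ∀ Y .{{_ : NonZero Y}} → bits Y * length (primes Y) ≤ 8 * Y
  primes-bound Y = begin
    b * length (primes Y)
      ≤⟨ *-monoʳ-≤ b (unique-⊆⇒length-≤ (Unique.filter⁺ prime? (Unique.upTo⁺ (suc Y))) sub) ⟩
    b * length (primes (2 ^ b))   ≤⟨ chebyshev b ⟩
    4 * (2 * 2 ^ lg Y)            ≡⟨ *-assoc 4 2 (2 ^ lg Y) ⟨
    8 * 2 ^ lg Y                  ≤⟨ *-monoʳ-≤ 8 (2^lg≤n Y) ⟩
    8 * Y                         ∎
    where
    open ≤-Reasoning
    b = bits Y
    sub : primes Y ⊆ primes (2 ^ b)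
    sub p∈ = let (pr , p≤Y) = ∈-primes⁻ p∈ in ∈-primes⁺ pr (≤-trans p≤Y (<⇒≤ (n<2^[1+lg] Y)))

  -- Real numbers

  fromℕℚ-mono : ∀ {m n} → m ≤ n → fromℕℚ m ℚ.≤ fromℕℚ n
  fromℕℚ-mono {m} {n} m≤n = ℚ.toℚᵘ-cancel-≤
    (ℚᵘ.≤-respʳ-≃ (ℚᵘ.≃-sym (toℚᵘ-/ (ℤ.+ n) 0))
    (ℚᵘ.≤-respˡ-≃ (ℚᵘ.≃-sym (toℚᵘ-/ (ℤ.+ m) 0))
    (ℚᵘ.*≤* (ℤ.*-monoʳ-≤-nonNeg (ℤ.+ 1) (ℤ.+≤+ m≤n)))))

  fromℕℚ-cancel-≤ : ∀ {m n} → fromℕℚ m ℚ.≤ fromℕℚ n → m ≤ n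
  fromℕℚ-cancel-≤ {m} {n} le = ℤ.drop‿+≤+ (ℤ.*-cancelʳ-≤-pos (ℤ.+ m) (ℤ.+ n) (ℤ.+ 1)
    (ℚᵘ.drop-*≤* (ℚᵘ.≤-respʳ-≃ (toℚᵘ-/ (ℤ.+ n) 0) (ℚᵘ.≤-respˡ-≃ (toℚᵘ-/ (ℤ.+ m) 0) (ℚ.toℚᵘ-mono-≤ le)))))

  fromℕℚ-* : ∀ m n → fromℕℚ m ℚ.* fromℕℚ n ≡ fromℕℚ (m * n)
  fromℕℚ-* m n = ℚ.toℚᵘ-injective
    (ℚᵘ.≃-trans (ℚ.toℚᵘ-homo-* (fromℕℚ m) (fromℕℚ n))
    (ℚᵘ.≃-trans (ℚᵘ.*-cong (toℚᵘ-/ (ℤ.+ m) 0) (toℚᵘ-/ (ℤ.+ n) 0))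
    (ℚᵘ.≃-trans (ℚᵘ.*≡* (cong (ℤ._* ℤ.+ 1) (sym (ℤ.pos-* m n))))
                (ℚᵘ.≃-sym (toℚᵘ-/ (ℤ.+ (m * n)) 0)))))

  recip-inverse : ∀ a → fromℕℚ (suc a) ℚ.* recip a ≡ 1ℚ
  recip-inverse a = subst (λ i → fromℕℚ (suc a) ℚ.* recip i ≡ 1ℚ) (*-identityʳ a) (fromℕℚ*recip a 0)

  harmonic-mono : ∀ a {l m} → l ≤ m → harmonic a l ℚ.≤ harmonic a m
  harmonic-mono a {l} l≤m with m≤n⇒∃[o]m+o≡n l≤m
  ... | o , refl = begin
    harmonic a l                               ≡⟨ ℚ.+-identityʳ (harmonic a l) ⟨
    harmonic a l ℚ.+ 0ℚ                        ≤⟨ ℚ.+-monoʳ-≤ (harmonic a l) (0≤ (a + l) o) ⟩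
    harmonic a l ℚ.+ harmonic (a + l) o        ≡⟨ harmonic-++ a l o ⟨
    harmonic a (l + o)                         ∎
    where
    open ℚ.≤-Reasoning
    0≤ : ∀ b o → 0ℚ ℚ.≤ harmonic b o
    0≤ b zero    = ℚ.≤-refl
    0≤ b (suc o) = ℚ.+-mono-≤ (0≤ b o) (ℚ.<⇒≤ (recip-pos (b + o)))

  -- Dyadic blocks: the 2^j terms from 1 / 2^j onwards are each at most 1 / 2^j, so a block adds at
  -- most 1.
  harmonic≤log₂ : ∀ j l → l < 2 ^ j → harmonic 0 l ℚ.≤ fromℕℚ j
  harmonic≤log₂ zero    l l<1 rewrite n<1⇒n≡0 l<1 = ℚ.≤-refl
  harmonic≤log₂ (suc j) l l<2^ = begin
    harmonic 0 l                               ≤⟨ harmonic-mono 0 l≤ ⟩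
    harmonic 0 (a + suc a)                     ≡⟨ harmonic-++ 0 a (suc a) ⟩
    harmonic 0 a ℚ.+ harmonic a (suc a)
      ≤⟨ ℚ.+-mono-≤ (harmonic≤log₂ j a (≤-reflexive 1+a≡2^j)) (harmonic-≤ a (suc a)) ⟩
    fromℕℚ j ℚ.+ fromℕℚ (suc a) ℚ.* recip a    ≡⟨ cong (fromℕℚ j ℚ.+_) (recip-inverse a) ⟩
    fromℕℚ j ℚ.+ 1ℚ                            ≡⟨ fromℕℚ-suc j ⟨
    fromℕℚ (suc j)                             ∎
    where
    open ℚ.≤-Reasoning
    a = pred (2 ^ j)
    1+a≡2^j : suc a ≡ 2 ^ j
    1+a≡2^j = suc-pred (2 ^ j) {{m^n≢0 2 j}}
    l≤ : l ≤ a + suc a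
    l≤ = s≤s⁻¹ (subst (l <_) (trans (cong (2 *_) (sym 1+a≡2^j)) (cong (suc a +_) (+-identityʳ (suc a)))) l<2^)

  -- Brings a comparison of cuts down to natural numbers. Lower cuts are strict, so the rational
  -- tested is `m`, not `suc m`, and one unit is lost.
  ≤ᴿ-recip-log : ∀ {a m N b} .{{_ : ℚ.Positive (recip a)}} → N < 2 ^ b →
    fromℕ (suc m) ≤ᴿ recip a · log N → suc a * m ≤ b
  ≤ᴿ-recip-log {a} {m} {N} {b} N<2^b 1+m≤ with 1+m≤ {fromℕℚ m} m<1+m
    where
    m<1+m : fromℕℚ m ℚ.< fromℕℚ (suc m)
    m<1+m = subst (fromℕℚ m ℚ.<_) (sym (fromℕℚ-suc m)) (p<p+1 (fromℕℚ m))
  ... | n , m/ε< = fromℕℚ-cancel-≤ (begin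
    fromℕℚ (suc a * m)                     ≡⟨ cong fromℕℚ (*-comm (suc a) m) ⟩
    fromℕℚ (m * suc a)                     ≡⟨ fromℕℚ-* m (suc a) ⟨
    fromℕℚ m ℚ.* fromℕℚ (suc a)            ≡⟨ cong (fromℕℚ m ℚ.*_) 1/recip ⟨
    fromℕℚ m ℚ.÷ recip a                   <⟨ m/ε< ⟩
    -- The upper sum of mesh 1 already suffices: it is a harmonic sum of N - 1 terms.
    lowerSum N n                           ≤⟨ lowerSum≤upperSum N n 0 ⟩
    harmonic 0 (N ∸ 1 + 0)
      ≤⟨ harmonic≤log₂ b (N ∸ 1 + 0) (≤-<-trans (≤-trans (≤-reflexive (+-identityʳ (N ∸ 1))) (m∸n≤m N 1)) N<2^b) ⟩
    fromℕℚ b                               ∎)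
    where
    open ℚ.≤-Reasoning
    instance
      ε≢0 : ℚ.NonZero (recip a)
      ε≢0 = ℚ.pos⇒nonZero (recip a)
    1/recip : ℚ.1/ recip a ≡ fromℕℚ (suc a)
    1/recip = begin-equality
      ℚ.1/ recip a                                       ≡⟨ ℚ.*-identityˡ (ℚ.1/ recip a) ⟨
      1ℚ ℚ.* ℚ.1/ recip a                                ≡⟨ cong (ℚ._* ℚ.1/ recip a) (recip-inverse a) ⟨
      fromℕℚ (suc a) ℚ.* recip a ℚ.* ℚ.1/ recip a        ≡⟨ ℚ.*-assoc (fromℕℚ (suc a)) (recip a) (ℚ.1/ recip a) ⟩
      fromℕℚ (suc a) ℚ.* (recip a ℚ.* ℚ.1/ recip a)      ≡⟨ cong (fromℕℚ (suc a) ℚ.*_) (ℚ.*-inverseʳ (recip a)) ⟩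
      fromℕℚ (suc a) ℚ.* 1ℚ                              ≡⟨ ℚ.*-identityʳ (fromℕℚ (suc a)) ⟩
      fromℕℚ (suc a)                                     ∎

  -- Stands in for the floor of a real number, which is not computable from its cut.
  ¬¬-maximum : ∀ {P : ℕ → Set} {a} B → P a → (∀ m → P m → m ≤ B) →
    ¬ ¬ (∃[ m ] P m × (∀ n → P n → n ≤ m))
  ¬¬-maximum {a = a} zero    pa P≤ k = k (a , pa , λ n pn → ≤-trans (P≤ n pn) z≤n)
  ¬¬-maximum {P} (suc B) pa P≤ k = ¬¬-excluded-middle λ
    { (yes pB) → k (suc B , pB , P≤)
    ; (no ¬pB) → ¬¬-maximum B pa (λ m pm → s≤s⁻¹ (≤∧≢⇒< (P≤ m pm) λ { refl → ¬pB pm })) k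
    }

  record IsFloor (y : ℝ) (Y : ℕ) : Set where
    field
      floor≤   : fromℕ Y ≤ᴿ y
      greatest : ∀ m → fromℕ m ≤ᴿ y → m ≤ Y

  Smooth⇒ : ∀ {y Y n} → IsFloor y Y → Smooth y n → NonZero n × Y -smooth n
  Smooth⇒ {n = n} floor (n≢0 , P⁺≤y) = n≢0 , λ p-prime p∣n →
    ≤-trans (All.lookup (xs≤max 1 (factors f)) (factorisationHasAllPrimeFactors p-prime
      (subst (_ ∣_) isFactorisation p∣n) factorsPrime)) (IsFloor.greatest floor (P⁺ n {{n≢0}}) P⁺≤y)
    where
    f = factorise n {{n≢0}}
    open PrimeFactorisation f using (isFactorisation; factorsPrime)

  -- The condition `1 ≤ Y` covers the default value `1` in the maximum defining `P⁺`.
  Smooth⇐ : ∀ {y Y n} → IsFloor y Y → 1 ≤ Y → NonZero n × Y -smooth n → Smooth y n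
  Smooth⇐ {Y = Y} {n} floor 1≤Y (n≢0 , smooth) = n≢0 , λ q<P⁺ →
    IsFloor.floor≤ floor (ℚ.<-≤-trans q<P⁺ (fromℕℚ-mono (max≤v⁺ {xs = factors f} 1≤Y (All.tabulate λ q∈ →
      smooth (All.lookup factorsPrime q∈) (subst (_ ∣_) (sym isFactorisation) (∈⇒∣product q∈))))))
    where
    f = factorise n {{n≢0}}
    open PrimeFactorisation f using (isFactorisation; factorsPrime)

  vecProduct-smooth : ∀ {Y N k} {xs : Vec ℕ k} → VecAll.All (λ x → x ≤ N × NonZero x × Y -smooth x) xs →
    let n = Vec.foldr′ _*_ 1 xs in n ≤ N ^ k × NonZero n × Y -smooth n
  vecProduct-smooth [] = ≤-refl , _ , λ p-prime p∣1 → contradiction (subst Prime (∣1⇒≡1 p∣1) p-prime) ¬prime[1]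
  vecProduct-smooth {xs = x ∷ xs} ((x≤N , x≢0 , x-smooth) ∷ good) with vecProduct-smooth good
  ... | n≤ , n≢0 , n-smooth = *-mono-≤ x≤N n≤ , m*n≢0 x _ {{x≢0}} {{n≢0}} , λ p-prime p∣xn →
    [ x-smooth p-prime , n-smooth p-prime ]′ (euclidsLemma x _ p-prime p∣xn)

  ∣M/Ψ-1∣≤recip : ∀ M Ψ .{{_ : NonZero Ψ}} n → M ≤ Ψ → suc n * (Ψ ∸ M) ≤ Ψ →
    ℚ.∣ ℤ.+ M ℚ./ Ψ ℚ.- 1ℚ ∣ ℚ.≤ recip n
  ∣M/Ψ-1∣≤recip M Ψ@(suc d) n M≤Ψ h with ℚ.∣p∣≡p∨∣p∣≡-p (ℤ.+ M ℚ./ Ψ ℚ.- 1ℚ)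
  ... | inj₁ eq = subst (ℚ._≤ recip n) (sym eq) (ℚ.≤-trans
        (ℚ.≤-trans (ℚ.+-monoˡ-≤ (ℚ.- 1ℚ) r≤1) (ℚ.≤-reflexive (ℚ.+-inverseʳ 1ℚ))) (ℚ.<⇒≤ (recip-pos n)))
    where
    r≤1 : ℤ.+ M ℚ./ Ψ ℚ.≤ 1ℚ
    r≤1 = ℚ.toℚᵘ-cancel-≤ (ℚᵘ.≤-respˡ-≃ (ℚᵘ.≃-sym (toℚᵘ-/ (ℤ.+ M) d))
      (ℚᵘ.*≤* (subst₂ ℤ._≤_ (sym (ℤ.*-identityʳ (ℤ.+ M))) (sym (ℤ.*-identityˡ (ℤ.+ Ψ))) (ℤ.+≤+ M≤Ψ))))
  ... | inj₂ eq = subst (ℚ._≤ recip n) (sym eq) (begin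
    ℚ.- (r ℚ.- 1ℚ)                ≡⟨ solve 2 (λ r o → :- (r :- o) := o :- r) refl r 1ℚ ⟩
    1ℚ ℚ.- r                      ≤⟨ ℚ.+-monoˡ-≤ (ℚ.- r) 1≤r+recip ⟩
    r ℚ.+ recip n ℚ.- r           ≡⟨ solve 2 (λ r s → r :+ s :- r := s) refl r (recip n) ⟩
    recip n                       ∎)
    where
    open ℚ.≤-Reasoning
    open +-*-Solver
    r = ℤ.+ M ℚ./ Ψ
    -- This is 1 ≤ M / Ψ + 1 / (n + 1) with denominators cleared.
    cross : Ψ * suc n ≤ M * suc n + Ψ
    cross = ≤-trans (≤-reflexive (trans (cong (_* suc n) (sym (m+[n∸m]≡n M≤Ψ))) (*-distribʳ-+ (suc n) M (Ψ ∸ M))))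
      (+-monoʳ-≤ (M * suc n) (≤-trans (≤-reflexive (*-comm (Ψ ∸ M) (suc n))) h))
    1≤r+recip : 1ℚ ℚ.≤ r ℚ.+ recip n
    1≤r+recip = ℚ.toℚᵘ-cancel-≤
      (ℚᵘ.≤-respʳ-≃ (ℚᵘ.≃-sym (ℚᵘ.≃-trans (ℚ.toℚᵘ-homo-+ r (recip n))
        (ℚᵘ.+-cong (toℚᵘ-/ (ℤ.+ M) d) (toℚᵘ-/ (ℤ.+ 1) n))))
      (ℚᵘ.*≤* (subst₂ ℤ._≤_ (sym (ℤ.*-identityˡ _)) (trans
        (cong₂ ℤ._+_ (ℤ.pos-* M (suc n)) (sym (ℤ.*-identityˡ (ℤ.+ Ψ))))
        (sym (ℤ.*-identityʳ _))) (ℤ.+≤+ cross))))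

  -- Comparison of the cardinalities

  -- The integer form of 2 ≤ y ≤ log N / (a + 2). The predecessor of `Y` reflects the unit lost at
  -- the strict cut; `Y ≤ N` follows because pred Y ≥ 1 and the coefficient is at least 2.
  floor-bounds : ∀ {a y N Y} .{{_ : ℚ.Positive (recip (suc a))}} .{{_ : NonZero N}} →
    IsFloor y Y → fromℕ 2 ≤ᴿ y → y ≤ᴿ recip (suc a) · log N →
    2 ≤ Y × Y ≤ N × (2 + a) * pred Y ≤ suc (lg N)
  floor-bounds {a} {y} {N} {Y} floor 2≤y y≤log with Y | IsFloor.greatest floor 2 2≤y | IsFloor.floor≤ floor
  ... | suc m | s≤s 1≤m | 1+m≤y = s≤s 1≤m , 1+m≤N , Am≤
    where
    open ≤-Reasoning
    Am≤ : (2 + a) * m ≤ suc (lg N)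
    Am≤ = ≤ᴿ-recip-log {suc a} {m} {N} (n<2^[1+lg] N) (y≤log ∘ 1+m≤y)
    1+m≤N : suc m ≤ N
    1+m≤N = begin
      1 + m                   ≤⟨ +-monoˡ-≤ m 1≤m ⟩
      m + m                   ≤⟨ +-monoʳ-≤ m (m≤m+n m (a * m)) ⟩
      (2 + a) * m             ≤⟨ Am≤ ⟩
      suc (lg N)              ≤⟨ n<2^n (lg N) ⟩
      2 ^ lg N                ≤⟨ 2^lg≤n N ⟩
      N                       ∎

  -- Put m = Y - 1, so Y ≤ 2 m. Then 4 π(Y) bits Y ≤ 32 Y ≤ 64 m, whence the 64. The 3 in `3 + d`
  -- absorbs S m from rounding `L` and 2 S m from `S * bits Y`.
  shell-small : ∀ d E S Ψ L Y → 64 * E ≤ d → 2 ≤ Y → (3 + d) * pred Y ≤ suc L →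
    S * L ≤ 4 * (bits Y * length (primes Y)) * Ψ + S * bits Y → E * S ≤ Ψ
  shell-small d E S Ψ L Y 64E≤d 2≤Y Am≤ S*L≤ =
    *-cancelˡ-≤ (64 * m) (+-cancelʳ-≤ (3 * (S * m)) _ _ (begin
    64 * m * (E * S) + 3 * (S * m)                ≡⟨ regroup₁ 64 m E S ⟩
    S * ((3 + 64 * E) * m)                        ≤⟨ *-monoʳ-≤ S (*-monoˡ-≤ m (+-monoʳ-≤ 3 64E≤d)) ⟩
    S * ((3 + d) * m)                             ≤⟨ *-monoʳ-≤ S Am≤ ⟩
    S * suc L                                     ≡⟨ *-suc S L ⟩
    S + S * L                                     ≤⟨ +-monoʳ-≤ S S*L≤ ⟩
    S + (4 * (bits Y * π) * Ψ + S * bits Y)       ≤⟨ +-mono-≤ (m≤m*n S m)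
                                                       (+-mono-≤ (*-monoˡ-≤ Ψ 4bπ≤) (*-monoʳ-≤ S bits≤2m)) ⟩
    S * m + (64 * m * Ψ + S * (m + m))            ≡⟨ regroup₂ (64 * m) m S Ψ ⟩
    64 * m * Ψ + 3 * (S * m)                      ∎))
    where
    open ≤-Reasoning
    m = pred Y
    π = length (primes Y)
    1≤m : 1 ≤ m
    1≤m = pred-mono-≤ 2≤Y
    instance
      m≢0 : NonZero m
      m≢0 = >-nonZero 1≤m
      Y≢0 : NonZero Y
      Y≢0 = >-nonZero (<⇒≤ 2≤Y)
      64m≢0 : NonZero (64 * m)
      64m≢0 = m*n≢0 64 m
    sixtyfour : ∀ m → 4 * (8 * (m + m)) ≡ 64 * m
    sixtyfour = solve-∀
    Y≤2m : Y ≤ m + m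
    Y≤2m = subst (_≤ m + m) (suc-pred Y) (+-monoˡ-≤ m 1≤m)
    bits≤2m : bits Y ≤ m + m
    bits≤2m = ≤-trans (≤-trans (n<2^n (lg Y)) (2^lg≤n Y)) Y≤2m
    4bπ≤ : 4 * (bits Y * π) ≤ 64 * m
    4bπ≤ = begin
      4 * (bits Y * π)     ≤⟨ *-monoʳ-≤ 4 (primes-bound Y) ⟩
      4 * (8 * Y)          ≤⟨ *-monoʳ-≤ 4 (*-monoʳ-≤ 8 Y≤2m) ⟩
      4 * (8 * (m + m))    ≡⟨ sixtyfour m ⟩
      64 * m               ∎
    regroup₁ : ∀ c m E S → c * m * (E * S) + 3 * (S * m) ≡ S * ((3 + c * E) * m)
    regroup₁ = solve-∀
    regroup₂ : ∀ d m S Ψ → S * m + (d * Ψ + S * (m + m)) ≡ d * Ψ + 3 * (S * m)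
    regroup₂ = solve-∀

  smooth-divisor : ∀ {X Y} m d → m * d ≤ X × NonZero (m * d) × Y -smooth (m * d) →
    m ≤ X × NonZero m × Y -smooth m
  smooth-divisor m d (md≤X , md≢0 , smooth) =
      ≤-trans (m≤m*n m d {{m*n≢0⇒n≢0 m {{md≢0}}}}) md≤X
    , m*n≢0⇒m≢0 m {{md≢0}}
    , λ p-prime p∣m → smooth p-prime (∣m⇒∣m*n d p∣m)

  smoothProduct⇒ : ∀ {k N y Y n} → IsFloor y Y → SmoothProduct k N y n →
    n ≤ N ^ k × NonZero n × Y -smooth n
  smoothProduct⇒ {N = N} {y} {Y} floor (xs , good , refl) = vecProduct-smooth
    (VecAll.map {P = λ x → x ≤ N × Smooth y x} (λ (x≤N , x-smooth) → x≤N , Smooth⇒ floor x-smooth) good)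

  pack⇒smoothProduct : ∀ {k N y Y n} .{{_ : NonZero N}} → IsFloor y Y → 1 ≤ Y → Y ≤ N →
    NonZero n × Y -smooth n → n * Y ^ k ≤ N ^ k → SmoothProduct k N y n
  pack⇒smoothProduct {k} {N} {y} {Y} {n} floor 1≤Y Y≤N (n≢0 , smooth) nD≤X =
    let (qs , ps , Πqs≡n) = smooth-factors n {{n≢0}} smooth
        (xs , good , Πxs≡Πqs) = pack Y≤N k qs ps (subst (λ n → n * Y ^ k ≤ N ^ k) (sym Πqs≡n) nD≤X)
    in xs
     , VecAll.map {P = λ x → x ≤ N × NonZero x × Y -smooth x}
         (λ (x≤N , x-smooth) → x≤N , Smooth⇐ floor 1≤Y x-smooth) good
     , trans Πxs≡Πqs Πqs≡n

  -- Every product is smooth and at most N^k, and every smooth integer up to N^k is a product or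
  -- lies in the shell; so Ψ - M is at most the size of the shell.
  floor⇒card-bounds : ∀ {d E y Y N k M Ψ} .{{_ : NonZero N}} .{{_ : NonZero k}} →
    64 * E ≤ d → IsFloor y Y → 2 ≤ Y → Y ≤ N → (3 + d) * pred Y ≤ suc (lg N) →
    HasCard (SmoothProduct k N y) M → HasCard (SmoothUpTo (N ^ k) y) Ψ →
    M ≤ Ψ × E * (Ψ ∸ M) ≤ Ψ × 0 < Ψ
  floor⇒card-bounds {d} {E} {y} {Y} {N} {k} {M} {Ψ}
    64E≤d floor 2≤Y Y≤N AY≤ (xs , xs! , xs⇔ , refl) (V , V! , V⇔ , refl) =
      unique-⊆⇒length-≤ xs! xs⊆V
    , ≤-trans (*-monoʳ-≤ E Ψ∸M≤S) (shell-small d E S (length V) (lg N) Y 64E≤d 2≤Y AY≤ small)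
    , ∈-length 1∈V
    where
    1≤Y = <⇒≤ 2≤Y
    V⇒ : ∀ {n} → n ∈ V → n ≤ N ^ k × NonZero n × Y -smooth n
    V⇒ {n} n∈V = let (n≤ , smooth) = Equivalence.to (V⇔ n) n∈V in n≤ , Smooth⇒ floor smooth
    V⇐ : ∀ {n} → n ≤ N ^ k × NonZero n × Y -smooth n → n ∈ V
    V⇐ {n} (n≤ , smooth) = Equivalence.from (V⇔ n) (n≤ , Smooth⇐ floor 1≤Y smooth)
    V-closed : ∀ m d → m * d ∈ V → m ∈ V
    V-closed m d = V⇐ ∘ smooth-divisor m d ∘ V⇒
    open Shell {N ^ k} {Y ^ k} {N ^ k} V! V-closed
    S = length shell
    xs⊆V : xs ⊆ V
    xs⊆V {n} n∈xs = V⇐ (smoothProduct⇒ floor (Equivalence.to (xs⇔ n) n∈xs))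
    V⊆ : V ⊆ xs ++ shell
    V⊆ {n} n∈V =
      [ (λ X<nD → ∈-++⁺ʳ xs (∈-filter⁺ inShell? n∈V (X<nD , proj₁ (V⇒ n∈V))))
      , (λ nD≤X → ∈-++⁺ˡ (Equivalence.from (xs⇔ n)
          (pack⇒smoothProduct floor 1≤Y Y≤N (proj₂ (V⇒ n∈V)) nD≤X)))
      ]′ (<-≤-connex (N ^ k) (n * Y ^ k))
    Ψ∸M≤S : Ψ ∸ M ≤ S
    Ψ∸M≤S = m≤n+o⇒m∸n≤o Ψ M (≤-trans (unique-⊆⇒length-≤ V! V⊆) (≤-reflexive (length-++ xs)))
    1∈V : 1 ∈ V
    1∈V = V⇐ (m^n>0 N k , _ , λ p-prime p∣1 → ≤-trans (∣⇒≤ p∣1) 1≤Y)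
    small : S * lg N ≤ 4 * (bits Y * length (primes Y)) * length V + S * bits Y
    small = shell-bound {N} {Y} {k} {bits Y} {lg N} V! V-closed (proj₂ ∘ V⇒) (n<2^[1+lg] Y) (2^lg≤n N)

  -- The conclusion is decidable, hence stable under double negation, so a floor of `y` that exists
  -- only up to double negation is enough.
  card-bounds : ∀ {d E y N k M Ψ} .{{_ : ℚ.Positive (recip (2 + d))}} .{{_ : NonZero N}}
    .{{_ : NonZero k}} →
    64 * E ≤ d → fromℕ 2 ≤ᴿ y → y ≤ᴿ recip (2 + d) · log N →
    HasCard (SmoothProduct k N y) M → HasCard (SmoothUpTo (N ^ k) y) Ψ →
    M ≤ Ψ × E * (Ψ ∸ M) ≤ Ψ × 0 < Ψ
  card-bounds {d} {E} {y} {N} {k} {M} {Ψ} 64E≤d 2≤y y≤log M-card Ψ-card =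
    decidable-stable (M ≤? Ψ ×-dec E * (Ψ ∸ M) ≤? Ψ ×-dec 0 <? Ψ) λ ¬goal →
      -- The search starts from 2 ≤ y; its upper limit comes from y ≤ log N, plus one for rounding
      -- and one for the strict cut.
      ¬¬-maximum {λ m → fromℕ m ≤ᴿ y} {2} (suc (suc (lg N))) 2≤y bounded λ (Y , Y≤y , Y-max) →
        let floor : IsFloor y Y
            floor = record { floor≤ = Y≤y ; greatest = Y-max }
            (2≤Y , Y≤N , AY≤) = floor-bounds {1 + d} floor 2≤y y≤log
        in ¬goal (floor⇒card-bounds {d} {E} 64E≤d floor 2≤Y Y≤N AY≤ M-card Ψ-card)
    where
    bounded : ∀ m → fromℕ m ≤ᴿ y → m ≤ suc (suc (lg N))
    bounded zero    _    = z≤n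
    bounded (suc m) 1+m≤ = s≤s (≤-trans (m≤m+n m _)
      (≤ᴿ-recip-log {2 + d} {m} {N} (n<2^[1+lg] N) (y≤log ∘ 1+m≤)))

  -- The threshold comes from `y =o log` at 1 / (d + 3), before `k` is introduced; this gives the
  -- uniformity.
  eventually-card-bounds : ∀ {y : ℕ → ℝ} d E → 64 * E ≤ d →
    (∀ N → 2 ≤ N → fromℕ 2 ≤ᴿ y N) → y =o log →
    ∃[ N₀ ] (∀ N → 2 ≤ N → N₀ ≤ N → ∀ k → 1 ≤ k → ∀ M Ψ →
      HasCard (SmoothProduct k N (y N)) M → HasCard (SmoothUpTo (N ^ k) (y N)) Ψ →
      M ≤ Ψ × E * (Ψ ∸ M) ≤ Ψ × 0 < Ψ)
  eventually-card-bounds {y} d E 64E≤d 2≤y y=o = proj₁ threshold , λ N 2≤N N₀≤N k 1≤k M Ψ →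
    card-bounds {d} {E} {y N} {{ε>0}} {{>-nonZero (<⇒≤ 2≤N)}} {{>-nonZero 1≤k}} 64E≤d
      (2≤y N 2≤N) (proj₂ threshold N N₀≤N)
    where
    ε>0 : ℚ.Positive (recip (2 + d))
    ε>0 = ℚ.normalize-pos 1 (3 + d)
    threshold = y=o (recip (2 + d)) {{ε>0}}

-- Choice of parameters for a given `ε`

open import Data.Integer using (+_)
open import Data.Nat using (ℕ; NonZero; _^_) renaming (_≤_ to _≤ℕ_)
open import Data.Product using (Σ; ∃-syntax)
open import Data.Rational using (ℚ; Positive; 1ℚ; _/_; _-_; _≤_; ∣_∣)
open import Defs
open import Data.Nat using (suc; >-nonZero; _*_)
open import Data.Nat.Properties using () renaming (≤-refl to ≤ℕ-refl)
open import Data.Product using (_,_)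
open import Data.Rational.Properties using (positive⁻¹; <⇒≤; ≤-trans)
open Counting using (eventually-card-bounds; ∣M/Ψ-1∣≤recip)

theorem1p1 : (y : ℕ → ℝ) →
    (∀ N → 2 ≤ℕ N → fromℕ 2 ≤ᴿ y N) →
    y =o log →
    ∀ (ε : ℚ) .{{_ : Positive ε}} →
    ∃[ N₀ ] (∀ N → 2 ≤ℕ N → N₀ ≤ℕ N →
    ∀ k → 1 ≤ℕ k →
    ∀ M Ψ →
    HasCard (SmoothProduct k N (y N)) M →
    HasCard (SmoothUpTo (N ^ k) (y N)) Ψ →
    Σ (NonZero Ψ) λ Ψ≢0 → ∣ (+ M / Ψ) {{Ψ≢0}} - 1ℚ ∣ ≤ ε)
theorem1p1 y 2≤y y=o ε =
  let (n , recip<ε) = archimedean (positive⁻¹ ε)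
      -- With E = n + 1 the missed part is at most Ψ / (n + 1), and 1 / (n + 1) < ε; d = 64 E is the
      -- least value allowed.
      (N₀ , bounds) = eventually-card-bounds {y} (64 * suc n) (suc n) ≤ℕ-refl 2≤y y=o
  in N₀ , λ N 2≤N N₀≤N k 1≤k M Ψ M-card Ψ-card →
    let (M≤Ψ , E[Ψ∸M]≤Ψ , Ψ>0) = bounds N 2≤N N₀≤N k 1≤k M Ψ M-card Ψ-card
        Ψ≢0 = >-nonZero Ψ>0
    in Ψ≢0 , ≤-trans (∣M/Ψ-1∣≤recip M Ψ {{Ψ≢0}} n M≤Ψ E[Ψ∸M]≤Ψ) (<⇒≤ recip<ε)
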